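{- Let $G$ be a plane elementary bipartite graph with $n$ finite faces $s_1,\dots,s_n$, where $n\ge 1$. Then $\mathrm{idim}(R(G))\ge n$, and $\mathrm{idim}(R(G))=n$ if and only if the infinite face of $G$ is forcing. Moreover, if $\mathrm{idim}(R(G))=n$, then the map $\phi: M\mapsto \phi_M=\phi_M(s_1)\phi_M(s_2)\cdots\phi_M(s_n)$ is a binary coding of length $n$ of all perfect matchings of $G$ (i.e. $\phi_M\in\{0,1\}^n$ for every $M\in\mathcal{M}(G)$) which induces an isometric embedding of $R(G)$ into the hypercube $Q_n$ as the finite distributive lattice $(\mathcal{M}(G),\le_L)$, whose Hasse diagram is isomorphic to $\overrightarrow{R}(G)$ (that is, $\phi$ is distance-preserving from $R(G)$ into $Q_n$, and $M'\le_L M$ iff $\phi_{M'}\le\phi_M$ componentwise).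
   Context: All graphs are finite. A perfect matching of a graph is a set of pairwise vertex-disjoint edges covering all vertices; $\mathcal{M}(G)$ is the set of perfect matchings of $G$. An edge is forbidden if it lies in no perfect matching. A bipartite graph is elementary if it is connected and has no forbidden edges. For a plane graph, $\partial s$ denotes the facial cycle (periphery) of a finite face $s$; the periphery of $G$ is the boundary of the infinite face. The resonance graph $R(G)$ has vertex set $\mathcal{M}(G)$, with $M_1M_2$ an edge iff the symmetric difference $M_1\oplus M_2$ is the facial cycle of a finite face of $G$. Fix a proper coloring of the vertices of $G$ in black and white. For $M\in\mathcal{M}(G)$, a cycle is $M$-alternating if its edges are alternately in and out of $M$; an $M$-alternating cycle $C$ is proper (resp. improper) if every edge of $C$ in $M$ goes from a white to a black vertex (resp. from black to white) along the clockwise orientation of $C$. There is a unique $M_{\hat 0}\in\mathcal{M}(G)$ such that $G$ has no proper $M_{\hat 0}$-alternating cycle. The resonance digraph $\overrightarrow{R}(G)$ orients the edge $M_1M_2$ of $R(G)$ from $M_1$ to $M_2$ if $M_1\oplus M_2$ is a proper $M_1$-alternating facial cycle; $M'\le_L M$ means there is a directed path from $M$ to $M'$ in $\overrightarrow{R}(G)$. For $M\in\mathcal{M}(G)$ and a finite face $f$, $\phi_M(f)$ is the number of cycles of $M\oplus M_{\hat 0}$ having $f$ in their interior. The infinite face of $G$ is forcing if the periphery of $G$ is an even cycle and the graph obtained from $G$ by deleting all vertices of the periphery is either empty or has exactly one perfect matching. $Q_m$ is the $m$-dimensional hypercube (vertex set $\{0,1\}^m$, adjacency = differing in exactly one coordinate).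 The isometric dimension $\mathrm{idim}(H)$ of a graph $H$ isometrically embeddable in a hypercube is the least $m$ such that $H$ admits a distance-preserving embedding into $Q_m$. -}

module Defs where

open import Data.Nat using (ℕ; zero; suc; _+_; _*_; _≤_)
open import Data.Bool using (Bool; true; false; _xor_; _∨_)
open import Data.Fin using (Fin; zero; suc; inject₁; fromℕ; _≟_)
open import Data.Fin.Subset using (Subset; _∈_; ∣_∣)
open import Data.Vec using (Vec; lookup; tabulate; zipWith)
open import Data.List using (List; length)
open import Data.List.Relation.Unary.Unique.Propositional using (Unique)
import Data.List.Membership.Propositional as LM
open import Data.Product using (Σ; ∃; _×_; _,_)
open import Data.Sum using (_⊎_)
open import Data.Unit using (⊤)
open import Data.Empty using (⊥)
open import Function using (_∘_)
open import Function.Bundles using (_⇔_)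
open import Relation.Nullary using (¬_)
open import Relation.Nullary.Decidable using (⌊_⌋)
open import Relation.Binary.PropositionalEquality using (_≡_; _≢_)
open import Relation.Binary.Construct.Closure.ReflexiveTransitive using (Star)

module _ {V : Set} (Adj : V → V → Set) where
  data Walk : V → V → ℕ → Set where
    here : ∀ {u} → Walk u u 0
    step : ∀ {u w x k} → Adj u w → Walk w x k → Walk u x (suc k)

  Dist : V → V → ℕ → Set
  Dist u w k = Walk u w k × (∀ j → Walk u w j → k ≤ j)

iter : {A : Set} → (A → A) → ℕ → A → A
iter f zero x = x
iter f (suc k) x = f (iter f k x)

QAdj : {m : ℕ} → Vec Bool m → Vec Bool m → Set
QAdj {m} a b = ∃ λ (i : Fin m) → (lookup a i ≢ lookup b i)
                 × (∀ j → j ≢ i → lookup a j ≡ lookup b j)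

-- Plane graphs as connected genus-0 combinatorial maps.
-- Darts Fin d; α = edge involution (dart x goes from vert x to vert (α x));
-- σ = counterclockwise rotation of darts around their tail vertex;
-- faces = orbits of σ ∘ α; the face of dart x is the face on the RIGHT of x.
-- Vertices are labelled Fin v (labels = σ-orbits), faces Fin (suc n)
-- (labels = (σ∘α)-orbits); face zero is the infinite face,
-- face (suc i) is the finite face s_{i+1}.

record PlaneGraph (d v n : ℕ) : Set where
  field
    α        : Fin d → Fin d
    σ        : Fin d → Fin d
    σ⁻¹      : Fin d → Fin d
    α-invol  : ∀ x → α (α x) ≡ x
    α-nofix  : ∀ x → α x ≢ x
    σσ⁻¹     : ∀ x → σ (σ⁻¹ x) ≡ x
    σ⁻¹σ     : ∀ x → σ⁻¹ (σ x) ≡ x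
    vert     : Fin d → Fin v
    vert-surj  : ∀ u → ∃ λ x → vert x ≡ u
    vert-orbit : ∀ x y → (vert x ≡ vert y) ⇔ (∃ λ k → iter σ k x ≡ y)
    face     : Fin d → Fin (suc n)
    face-surj  : ∀ f → ∃ λ x → face x ≡ f
    face-orbit : ∀ x y → (face x ≡ face y) ⇔ (∃ λ k → iter (σ ∘ α) k x ≡ y)
    map-connected : ∀ x y → ∃ λ k → Walk (λ a b → (b ≡ α a) ⊎ (b ≡ σ a)) x y k
    -- Euler: V - E + F = 2 with E = d/2, F = n + 1  (genus 0, i.e. plane)
    euler    : 2 * v + 2 * suc n ≡ d + 4

module _ {d v n : ℕ} (G : PlaneGraph d v n) where
  open PlaneGraph G

  VAdj : Fin v → Fin v → Set
  VAdj u w = ∃ λ x → vert x ≡ u × vert (α x) ≡ w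

  -- edge sets are α-closed subsets of darts; perfect matchings of the
  -- subgraph induced by the vertices satisfying S
  IsPMOn : (Fin v → Set) → Subset d → Set
  IsPMOn S M = (∀ x → x ∈ M → α x ∈ M)
             × (∀ x → x ∈ M → S (vert x))
             × (∀ u → S u → ∃ λ x → x ∈ M × vert x ≡ u
                                × (∀ y → y ∈ M → vert y ≡ u → y ≡ x))

  IsPM : Subset d → Set
  IsPM = IsPMOn (λ _ → ⊤)

  Elementary : Set
  Elementary = (∀ u w → ∃ λ k → Walk VAdj u w k)
             × (∀ x → ∃ λ M → IsPM M × x ∈ M)

  symDiff : Subset d → Subset d → Subset d
  symDiff = zipWith _xor_

  boundary : Fin (suc n) → Subset d
  boundary f = tabulate λ x → ⌊ face x ≟ f ⌋ ∨ ⌊ face (α x) ≟ f ⌋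

  ResAdj : Subset d → Subset d → Set
  ResAdj M₁ M₂ = IsPM M₁ × IsPM M₂
               × ∃ λ (i : Fin n) → symDiff M₁ M₂ ≡ boundary (suc i)

  data ReachAvoid (E : Fin d → Set) : Fin (suc n) → Set where
    outer : ReachAvoid E zero
    cross : ∀ x → ¬ E x → ReachAvoid E (face x) → ReachAvoid E (face (α x))

  Interior : (Fin d → Set) → Fin (suc n) → Set
  Interior E f = ¬ ReachAvoid E f

  record Cycle : Set where
    field
      len    : ℕ
      dart   : Fin (suc len) → Fin d
      closed : ∀ (i : Fin len) → vert (α (dart (inject₁ i))) ≡ vert (dart (suc i))
      wrap   : vert (α (dart (fromℕ len))) ≡ vert (dart zero)
      vinj   : ∀ i j → vert (dart i) ≡ vert (dart j) → i ≡ j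
      edist  : ∀ i j → dart i ≢ α (dart j)

  open Cycle public

  OnCycle : Cycle → Fin d → Set
  OnCycle C y = ∃ λ i → (y ≡ dart C i) ⊎ (α y ≡ dart C i)

  -- C is listed in clockwise order (interior on the right of every dart)
  Clockwise : Cycle → Set
  Clockwise C = ∀ i → Interior (OnCycle C) (face (dart C i))

  Alternating : Subset d → Cycle → Set
  Alternating M C = (∀ (i : Fin (len C)) →
                       lookup M (dart C (inject₁ i)) ≢ lookup M (dart C (suc i)))
                  × (lookup M (dart C (fromℕ (len C))) ≢ lookup M (dart C zero))

  CycleOf : Subset d → Subset d → Set
  CycleOf H E = ∃ λ (C : Cycle) → (∀ y → (y ∈ E) ⇔ OnCycle C y)
                                 × (∀ y → y ∈ E → y ∈ H)

  Isometric : {m : ℕ} → (Subset d → Vec Bool m) → Set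
  Isometric c = ∀ M M' → IsPM M → IsPM M' → ∀ k →
                Dist ResAdj M M' k ⇔ Dist QAdj (c M) (c M') k

  Embeds : ℕ → Set
  Embeds m = ∃ λ (c : Subset d → Vec Bool m) → Isometric c

  IdimIs : ℕ → Set
  IdimIs m = Embeds m × (∀ m' → Embeds m' → m ≤ m')

  OnPeriphery : Fin d → Set
  OnPeriphery x = face x ≡ zero

  OffPeriphery : Fin v → Set
  OffPeriphery u = ∀ x → OnPeriphery x → vert x ≢ u

  PeripheryEvenCycle : Set
  PeripheryEvenCycle =
      (∀ x y → OnPeriphery x → OnPeriphery y → vert x ≡ vert y → x ≡ y)
    × (∀ x y → OnPeriphery x → OnPeriphery y → x ≢ α y)
    × (∃ λ j → ∣ tabulate (λ x → ⌊ face x ≟ zero ⌋) ∣ ≡ 2 * j)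

  Forcing : Set
  Forcing = PeripheryEvenCycle
          × ((∀ u → ¬ OffPeriphery u)
             ⊎ (∃ λ M → IsPMOn OffPeriphery M
                      × (∀ M' → IsPMOn OffPeriphery M' → M' ≡ M)))

  module _ (col : Fin v → Bool) where
    ProperColoring : Set
    ProperColoring = ∀ x → col (vert x) ≢ col (vert (α x))

    White Black : Fin v → Set
    White u = col u ≡ true
    Black u = col u ≡ false

    WhiteToBlack : Subset d → Cycle → Set
    WhiteToBlack M C = ∀ i → dart C i ∈ M →
                       White (vert (dart C i)) × Black (vert (α (dart C i)))

    ProperAlt : Subset d → Cycle → Set
    ProperAlt M C = Alternating M C × Clockwise C × WhiteToBlack M C

    IsBottom : Subset d → Set
    IsBottom M = IsPM M × ¬ (∃ λ C → ProperAlt M C)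

    -- the finite face f's periphery (darts with f on the right, traversed
    -- clockwise) is proper M-alternating: M-edges go white → black
    ProperFace : Subset d → Fin (suc n) → Set
    ProperFace M f = ∀ x → face x ≡ f → x ∈ M →
                     White (vert x) × Black (vert (α x))

    DirAdj : Subset d → Subset d → Set
    DirAdj M₁ M₂ = IsPM M₁ × IsPM M₂
                 × ∃ λ (i : Fin n) → symDiff M₁ M₂ ≡ boundary (suc i)
                                   × ProperFace M₁ (suc i)

    _≤L_ : Subset d → Subset d → Set
    M' ≤L M = Star DirAdj M M'

    PhiIs : Subset d → Subset d → Fin (suc n) → ℕ → Set
    PhiIs M₀ M f k = ∃ λ (L : List (Subset d)) → Unique L
                   × (∀ E → (E LM.∈ L) ⇔ (CycleOf (symDiff M M₀) E × Interior (_∈ E) f))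
                   × length L ≡ k

{-# OPTIONS --safe #-}

-- Every perfect matching M is encoded by a height function on the faces, which vanishes on the infinite
-- face and whose jump across a dart is the signed change from M₀ to M there; it exists because the map
-- has genus 0 (the complement of a spanning tree is a spanning tree of the dual).  By elementarity, the
-- dart orientation that says which faces cannot be raised (lowered) has no directed cycle, so from any
-- matching one can move towards any other by flipping single faces.  Hence the distance in the resonance
-- graph is the L¹-distance of heights, and ≤L is the pointwise order.  A height counts the cycles of
-- M ⊕ M₀ around a face, because removing one such cycle lowers the height by 1 exactly in its interior.
--
-- In M₀ the only face that can be lowered is the infinite one, which gives a matching N₁ of height 1 on
-- every finite face, at distance n from M₀.  So an isometric embedding into Q_m has n ≤ m, and for m = n
-- the images of M₀ and N₁ are antipodal, which forces all heights to be 0 or 1.  Finally, heights exceed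
-- 1 if and only if N₁ can be raised at some face; such a face is disjoint from the periphery, and raising
-- it changes the matching of the graph without the periphery.

module Submission where

open import Defs
open import Data.Nat as ℕ using (ℕ; zero; suc; _≤_; _<_; z≤n; s≤s)
import Data.Nat.Properties as ℕₚ
open import Data.Nat.Induction using (<-wellFounded)
open import Induction.WellFounded using (Acc; acc)
open import Data.Integer as ℤ using (ℤ; +_; -[1+_]; 0ℤ; 1ℤ; -1ℤ; +≤+; -≤+; ∣_∣; +<+)
import Data.Integer.Properties as ℤₚ
open import Data.Integer.Tactic.RingSolver using (solve-∀)
open import Algebra.Properties.CommutativeMonoid.Sum ℤₚ.+-0-commutativeMonoid
  using (sum; sum-cong-≗; sum-permute)
open import Algebra.Properties.CommutativeMonoid.Sum ℕₚ.+-0-commutativeMonoid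
  using () renaming (sum to sumℕ; sum-cong-≗ to sumℕ-cong; ∑-distrib-+ to sumℕ-+;
                     sum-permute to sumℕ-permute; sum-replicate-zero to sumℕ-zero)
open import Data.Bool as B using (Bool; true; false; if_then_else_; not; _xor_; _∨_; _∧_)
import Data.Bool.Properties as Bₚ
open import Data.Fin using (Fin; zero; suc; _≟_; toℕ; inject₁; fromℕ)
import Data.Fin.Properties as Finₚ
open import Data.Fin.Induction using (<-weakInduction; <-weakInduction-startingFrom)
open import Data.Fin.Permutation using (permutation)
open import Data.Fin.Relation.Unary.Top using (view; ‵fromℕ; ‵inject₁)
open import Data.Fin.Subset as Sub using (Subset)
import Data.Fin.Subset.Properties as Subₚ
open import Data.List as List using (List; []; _∷_; length; _++_)
open import Data.List.Properties using (length-++)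
open import Data.List.Membership.Propositional using (_∈_; _∉_)
open import Data.List.Membership.Propositional.Properties using (∈-lookup; ∈-++⁻)
open import Data.List.Membership.DecPropositional using (_∈?_)
open import Data.List.Relation.Unary.All as All using (All; []; _∷_)
open import Data.List.Relation.Unary.AllPairs using ([]; _∷_)
open import Data.List.Relation.Unary.Any using (here; there; index)
open import Data.List.Relation.Unary.Any.Properties using (lookup-index)
open import Data.List.Relation.Unary.Unique.Propositional using (Unique)
open import Data.List.Relation.Unary.Unique.Propositional.Properties using (++⁺)
open import Data.Vec using (Vec; lookup; tabulate; _[_]≔_)
open import Data.Vec.Properties
  using ([]=⇒lookup; lookup⇒[]=; lookup∘tabulate; tabulate∘lookup; tabulate-cong; lookup-zipWith;
         lookup∘update; lookup∘update′)
open import Data.Product using (∃; ∃₂; _×_; _,_; proj₁; proj₂)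
open import Data.Sum using (_⊎_; inj₁; inj₂)
open import Data.Unit using (⊤; tt)
open import Data.Empty using (⊥; ⊥-elim)
open import Function using (_∘_)
open import Function.Bundles using (_⇔_; mk⇔; module Equivalence)
open import Relation.Nullary using (¬_; Dec; yes; no; contradiction)
open import Relation.Nullary.Decidable using (⌊_⌋; _×-dec_; _⊎-dec_; ¬?; _→-dec_)
open import Relation.Unary using (Decidable)
open import Relation.Binary.Definitions using (tri<; tri≈; tri>)
open import Relation.Binary.PropositionalEquality
open import Relation.Binary.Construct.Closure.ReflexiveTransitive using (Star; ε; _◅_)

-- A combinatorial map carries no topology: there is no Jordan curve theorem at hand, and a facial
-- walk is not known in advance to be a simple cycle. Flows replace both. Signed by the colour of
-- the tail, the difference of two perfect matchings is antisymmetric and conserved at every vertex,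
-- and in genus 0 such a flow is the gradient of a function on faces. Flipping a face then means
-- adding a spike at that face, and the sides of a cycle are read off from the jump of an indicator,
-- which conservation keeps constant along the cycle.
--
-- Potentials treat all faces alike; normalising them to 0 on the infinite face comes last. This is
-- why lowering the infinite face raises all the others.
--
-- A Boolean `b` always names a direction: `true` raises a face, `false` lowers it. Lowering a
-- finite face is an arc of the resonance digraph.
--
-- The absence of proper cycles for `M₀` fixes a sign: each cycle of the difference contributes +1
-- to its interior, never -1, so heights are non-negative.

private variable k m : ℕ

-- Finite sums of integers and of bits.

sum-zero : (g : Fin k → ℤ) → (∀ i → g i ≡ 0ℤ) → sum g ≡ 0ℤ
sum-zero {zero} g g≡0 = refl
sum-zero {suc k} g g≡0 = cong₂ ℤ._+_ (g≡0 zero) (sum-zero (g ∘ suc) (g≡0 ∘ suc))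

sum-single : (g : Fin k → ℤ) (p : Fin k) → (∀ i → i ≢ p → g i ≡ 0ℤ) → sum g ≡ g p
sum-single g zero off =
  trans (cong (λ z → g zero ℤ.+ z) (sum-zero (g ∘ suc) λ i → off (suc i) λ ())) (ℤₚ.+-identityʳ _)
sum-single g (suc p) off =
  trans (cong₂ ℤ._+_ (off zero λ ()) (sum-single (g ∘ suc) p λ i i≢p → off (suc i) (i≢p ∘ Finₚ.suc-injective)))
        (ℤₚ.+-identityˡ _)

sum-pair : (g : Fin k → ℤ) (p q : Fin k) → p ≢ q → (∀ i → i ≢ p → i ≢ q → g i ≡ 0ℤ) →
           sum g ≡ g p ℤ.+ g q
sum-pair g zero zero p≢q off = contradiction refl p≢q
sum-pair g zero (suc q) p≢q off =
  cong (λ z → g zero ℤ.+ z) (sum-single (g ∘ suc) q λ i i≢q → off (suc i) (λ ()) (i≢q ∘ Finₚ.suc-injective))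
sum-pair g (suc p) zero p≢q off =
  trans (cong (λ z → g zero ℤ.+ z) (sum-single (g ∘ suc) p λ i i≢p → off (suc i) (i≢p ∘ Finₚ.suc-injective) λ ()))
        (ℤₚ.+-comm (g zero) _)
sum-pair g (suc p) (suc q) p≢q off =
  trans (cong₂ ℤ._+_ (off zero (λ ()) λ ())
          (sum-pair (g ∘ suc) p q (p≢q ∘ cong suc)
            λ i i≢p i≢q → off (suc i) (i≢p ∘ Finₚ.suc-injective) (i≢q ∘ Finₚ.suc-injective)))
        (ℤₚ.+-identityˡ _)

sum-sub : (f g : Fin k → ℤ) → sum (λ i → f i ℤ.- g i) ≡ sum f ℤ.- sum g
sum-sub {zero} f g = refl
sum-sub {suc k} f g =
  trans (cong (λ z → f zero ℤ.- g zero ℤ.+ z) (sum-sub (f ∘ suc) (g ∘ suc)))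
        (rearrange (f zero) (g zero) (sum (f ∘ suc)) (sum (g ∘ suc)))
  where
  rearrange : ∀ a b c e → a ℤ.- b ℤ.+ (c ℤ.- e) ≡ a ℤ.+ c ℤ.- (b ℤ.+ e)
  rearrange = solve-∀

sub-interchange : ∀ a b c e → (a ℤ.- b) ℤ.- (c ℤ.- e) ≡ (a ℤ.- c) ℤ.- (b ℤ.- e)
sub-interchange = solve-∀

*-distribˡ-sub : ∀ s i j → s ℤ.* (i ℤ.- j) ≡ s ℤ.* i ℤ.- s ℤ.* j
*-distribˡ-sub = solve-∀

bit : Bool → ℤ
bit b = if b then 1ℤ else 0ℤ

sum-bit : (g : Fin k → Bool) → sum (bit ∘ g) ≡ 0ℤ × (∀ i → g i ≡ false)
        ⊎ ∃ λ s → sum (bit ∘ g) ≡ + suc s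
sum-bit {zero} g = inj₁ (refl , λ ())
sum-bit {suc k} g with g zero in g₀ | sum-bit (g ∘ suc)
... | true  | inj₁ (eq , _) = inj₂ (0 , cong (λ z → 1ℤ ℤ.+ z) eq)
... | true  | inj₂ (s , eq) = inj₂ (suc s , cong (λ z → 1ℤ ℤ.+ z) eq)
... | false | inj₂ (s , eq) = inj₂ (s , cong (λ z → 0ℤ ℤ.+ z) eq)
... | false | inj₁ (eq , off) = inj₁ (cong (λ z → 0ℤ ℤ.+ z) eq , λ { zero → g₀ ; (suc i) → off i })

-- Turns a degree equal to 1 back into a unique incident dart, the form in which `IsPM` states it.
sum-bit≡1 : (g : Fin k → Bool) → sum (bit ∘ g) ≡ 1ℤ →
            ∃ λ i → g i ≡ true × (∀ j → g j ≡ true → j ≡ i)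
sum-bit≡1 {zero} g ()
sum-bit≡1 {suc k} g eq with g zero in g₀
sum-bit≡1 {suc k} g eq | true with sum-bit (g ∘ suc)
... | inj₁ (_ , off) = zero , g₀ , λ { zero _ → refl ; (suc j) gj → contradiction (trans (sym gj) (off j)) λ () }
... | inj₂ (s , eq′) = contradiction (trans (sym (cong (λ z → 1ℤ ℤ.+ z) eq′)) eq) λ ()
sum-bit≡1 {suc k} g eq | false with sum-bit≡1 (g ∘ suc) (trans (sym (ℤₚ.+-identityˡ _)) eq)
... | i , gi , unique = suc i , gi , λ { zero gj → contradiction (trans (sym g₀) gj) λ ()
                                       ; (suc j) gj → cong suc (unique j gj) }

-- Counting with duplicate-free lists.

lookup-injective : {A : Set} {xs : List A} → Unique xs → ∀ i j → List.lookup xs i ≡ List.lookup xs j → i ≡ j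
lookup-injective (_ ∷ _) zero zero eq = refl
lookup-injective {xs = x ∷ xs} (x∉ ∷ _) zero (suc j) eq = contradiction eq (All.lookup x∉ (∈-lookup {xs = xs} j))
lookup-injective {xs = x ∷ xs} (x∉ ∷ _) (suc i) zero eq = contradiction (sym eq) (All.lookup x∉ (∈-lookup {xs = xs} i))
lookup-injective (_ ∷ u) (suc i) (suc j) eq = cong suc (lookup-injective u i j eq)

unique-length≤ : {xs : List (Fin m)} → Unique xs → length xs ≤ m
unique-length≤ u = Finₚ.injective⇒≤ (λ {i} {j} → lookup-injective u i j)

complete-length≥ : (xs : List (Fin m)) → (∀ i → i ∈ xs) → m ≤ length xs
complete-length≥ xs all = Finₚ.injective⇒≤ {f = λ i → index (all i)}
  λ {i} {j} eq → trans (lookup-index (all i)) (trans (cong (List.lookup xs) eq) (sym (lookup-index (all j))))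

∉⇒All≢ : {A : Set} {x : A} {xs : List A} → x ∉ xs → All (x ≢_) xs
∉⇒All≢ {xs = []} _ = []
∉⇒All≢ {xs = y ∷ ys} x∉ = (x∉ ∘ here) ∷ ∉⇒All≢ (x∉ ∘ there)

unique-complete : {xs : List (Fin m)} → Unique xs → m ≤ length xs → ∀ i → i ∈ xs
unique-complete {m} {xs} u m≤ i with _∈?_ _≟_ i xs
... | yes i∈ = i∈
... | no i∉ = contradiction (ℕₚ.≤-trans (s≤s m≤) (unique-length≤ (∉⇒All≢ i∉ ∷ u))) (ℕₚ.<-irrefl refl)

sum-scale : ∀ c (f : Fin k → ℤ) → sum (λ i → c ℤ.* f i) ≡ c ℤ.* sum f
sum-scale {zero} c f = sym (ℤₚ.*-zeroʳ c)
sum-scale {suc k} c f =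
  trans (cong (λ s → c ℤ.* f zero ℤ.+ s) (sum-scale c (f ∘ suc))) (sym (ℤₚ.*-distribˡ-+ c (f zero) _))

lookup-ext : {A : Set} {xs ys : Vec A k} → (∀ i → lookup xs i ≡ lookup ys i) → xs ≡ ys
lookup-ext {xs = xs} {ys} eq = trans (sym (tabulate∘lookup xs)) (trans (tabulate-cong eq) (tabulate∘lookup ys))

∈⇒lookup : ∀ {x} {S : Subset k} → x Sub.∈ S → lookup S x ≡ true
∈⇒lookup = []=⇒lookup

lookup⇒∈ : ∀ {x} {S : Subset k} → lookup S x ≡ true → x Sub.∈ S
lookup⇒∈ {x = x} {S} = lookup⇒[]= x S

-- Signs, bits and indicators.

sign : Bool → ℤ
sign b = if b then 1ℤ else -1ℤ

sign-not : ∀ b → sign (not b) ≡ ℤ.- sign b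
sign-not true = refl
sign-not false = refl

sign-cancel : ∀ b {i j} → sign b ℤ.* (i ℤ.- j) ≡ 0ℤ → i ≡ j
sign-cancel true {i} {j} eq = ℤₚ.i-j≡0⇒i≡j i j (trans (sym (ℤₚ.*-identityˡ _)) eq)
sign-cancel false {i} {j} eq = ℤₚ.i-j≡0⇒i≡j i j
  (trans (sym (ℤₚ.neg-involutive _)) (cong ℤ.-_ (trans (sym (ℤₚ.-1*i≡-i _)) eq)))

bit-injective : ∀ {a b} → bit a ≡ bit b → a ≡ b
bit-injective {true} {true} _ = refl
bit-injective {false} {false} _ = refl

-- For a dart with tail colour c and weight m, c xor m is the direction in which its signed weight can
-- still change.
signed-change≤0 : ∀ b c m m′ → c xor m ≡ not b → sign b ℤ.* (sign c ℤ.* (bit m′ ℤ.- bit m)) ℤ.≤ 0ℤ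
signed-change≤0 true true true true _ = ℤₚ.≤-refl
signed-change≤0 true true true false _ = -≤+
signed-change≤0 true false false true _ = -≤+
signed-change≤0 true false false false _ = ℤₚ.≤-refl
signed-change≤0 false true false true _ = -≤+
signed-change≤0 false true false false _ = ℤₚ.≤-refl
signed-change≤0 false false true true _ = ℤₚ.≤-refl
signed-change≤0 false false true false _ = -≤+

signed-toggle : ∀ b c m → c xor m ≡ b → sign c ℤ.* (bit (m xor true) ℤ.- bit m) ≡ sign b
signed-toggle true true false _ = refl
signed-toggle true false true _ = refl
signed-toggle false true true _ = refl
signed-toggle false false false _ = refl

xor-not-not : ∀ a b → not a xor not b ≡ a xor b
xor-not-not true b = refl
xor-not-not false b = Bₚ.not-involutive b

indicator : Fin m → Fin m → ℤ
indicator f g = bit ⌊ g ≟ f ⌋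

indicator-refl : (f : Fin m) → indicator f f ≡ 1ℤ
indicator-refl f with f ≟ f
... | yes _ = refl
... | no f≢f = contradiction refl f≢f

indicator-≢ : {f g : Fin m} → g ≢ f → indicator f g ≡ 0ℤ
indicator-≢ {f = f} {g} g≢f with g ≟ f
... | yes eq = contradiction eq g≢f
... | no _ = refl

-- Sums of natural numbers, compared termwise.

sumℕ-suc : (f g : Fin k → ℕ) (i : Fin k) → f i ≡ suc (g i) → (∀ j → j ≢ i → f j ≡ g j) →
           sumℕ f ≡ suc (sumℕ g)
sumℕ-suc f g zero at-i off = cong₂ ℕ._+_ at-i (sumℕ-cong λ j → off (suc j) λ ())
sumℕ-suc f g (suc i) at-i off =
  trans (cong₂ ℕ._+_ (off zero λ ()) (sumℕ-suc (f ∘ suc) (g ∘ suc) i at-i λ j j≢i → off (suc j) (j≢i ∘ Finₚ.suc-injective)))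
        (ℕₚ.+-suc (g zero) _)

sumℕ-mono : (f g : Fin k → ℕ) → (∀ i → f i ≤ g i) → sumℕ f ≤ sumℕ g
sumℕ-mono {zero} f g f≤g = z≤n
sumℕ-mono {suc k} f g f≤g = ℕₚ.+-mono-≤ (f≤g zero) (sumℕ-mono (f ∘ suc) (g ∘ suc) (f≤g ∘ suc))

sumℕ-≤suc : (f g : Fin k → ℕ) (i : Fin k) → f i ≤ suc (g i) → (∀ j → j ≢ i → f j ≡ g j) →
            sumℕ f ≤ suc (sumℕ g)
sumℕ-≤suc f g zero at-i off = ℕₚ.+-mono-≤ at-i (ℕₚ.≤-reflexive (sumℕ-cong λ j → off (suc j) λ ()))
sumℕ-≤suc f g (suc i) at-i off = subst (sumℕ f ≤_) (ℕₚ.+-suc (g zero) _)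
  (ℕₚ.+-mono-≤ (ℕₚ.≤-reflexive (off zero λ ()))
    (sumℕ-≤suc (f ∘ suc) (g ∘ suc) i at-i λ j j≢i → off (suc j) (j≢i ∘ Finₚ.suc-injective)))

sumℕ≡0 : (f : Fin k → ℕ) → sumℕ f ≡ 0 → ∀ i → f i ≡ 0
sumℕ≡0 {suc k} f eq zero = ℕₚ.m+n≡0⇒m≡0 (f zero) eq
sumℕ≡0 {suc k} f eq (suc i) = sumℕ≡0 (f ∘ suc) (ℕₚ.m+n≡0⇒n≡0 (f zero) eq) i

sumℕ>0 : (f : Fin k → ℕ) → ∀ {s} → sumℕ f ≡ suc s → ∃ λ i → f i ≢ 0
sumℕ>0 {suc k} f eq with f zero in f₀
... | suc _ = zero , λ z → contradiction (trans (sym f₀) z) λ ()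
... | zero with sumℕ>0 (f ∘ suc) eq
...   | i , ≢0 = suc i , ≢0

sumℕ-ones : (f : Fin k → ℕ) → (∀ i → f i ≡ 1) → sumℕ f ≡ k
sumℕ-ones {zero} f ones = refl
sumℕ-ones {suc k} f ones = cong₂ ℕ._+_ (ones zero) (sumℕ-ones (f ∘ suc) (ones ∘ suc))

sumℕ≤⇒ones : (f : Fin k → ℕ) → (∀ i → 1 ≤ f i) → sumℕ f ≤ k → ∀ i → f i ≡ 1
sumℕ≤⇒ones {suc k} f pos bound = λ
  { zero → ℕₚ.≤-antisym (ℕₚ.+-cancelʳ-≤ k _ _ (ℕₚ.≤-trans (ℕₚ.+-monoʳ-≤ (f zero) rest≥) bound)) (pos zero)
  ; (suc i) → sumℕ≤⇒ones (f ∘ suc) (pos ∘ suc) (ℕₚ.≤-pred (ℕₚ.≤-trans (ℕₚ.+-monoˡ-≤ _ (pos zero)) bound)) i }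
  where
  rest≥ : k ≤ sumℕ (f ∘ suc)
  rest≥ = subst (_≤ sumℕ (f ∘ suc)) (sumℕ-ones (λ (_ : Fin k) → 1) (λ _ → refl))
                (sumℕ-mono (λ _ → 1) (f ∘ suc) (pos ∘ suc))

-- Hamming distance as the distance of the hypercube.

disagree : Bool → Bool → ℕ
disagree a b = if a xor b then 1 else 0

hamming : Vec Bool m → Vec Bool m → ℕ
hamming a b = sumℕ λ i → disagree (lookup a i) (lookup b i)

disagree≤1 : ∀ a b → disagree a b ≤ 1
disagree≤1 true true = z≤n
disagree≤1 true false = ℕₚ.≤-refl
disagree≤1 false true = ℕₚ.≤-refl
disagree≤1 false false = z≤n

disagree-refl : ∀ a → disagree a a ≡ 0
disagree-refl true = refl
disagree-refl false = refl

disagree≡0 : ∀ a b → disagree a b ≡ 0 → a ≡ b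
disagree≡0 true true _ = refl
disagree≡0 false false _ = refl

disagree≢0 : ∀ a b → disagree a b ≢ 0 → a ≢ b
disagree≢0 a .a ≢0 refl = ≢0 (disagree-refl a)

≢⇒disagree : ∀ a b → a ≢ b → disagree a b ≡ 1
≢⇒disagree true true a≢b = contradiction refl a≢b
≢⇒disagree true false _ = refl
≢⇒disagree false true _ = refl
≢⇒disagree false false a≢b = contradiction refl a≢b

-- Summed over the coordinates, this puts every vertex of a cube on a geodesic between two antipodal
-- ones.
disagree-antipodal : ∀ a b c → disagree a c ≡ 1 → disagree a b ℕ.+ disagree b c ≡ 1
disagree-antipodal true true false _ = refl
disagree-antipodal true false false _ = refl
disagree-antipodal false true true _ = refl
disagree-antipodal false false true _ = refl

hamming≤ : (a b : Vec Bool m) → hamming a b ≤ m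
hamming≤ {m} a b = subst (hamming a b ≤_) (sumℕ-ones (λ (_ : Fin m) → 1) (λ _ → refl))
  (sumℕ-mono _ (λ (_ : Fin m) → 1) λ i → disagree≤1 (lookup a i) (lookup b i))

hamming-lower : {a b : Vec Bool m} → Walk QAdj a b k → hamming a b ≤ k
hamming-lower {m = m} {a = a} here = ℕₚ.≤-reflexive
  (trans (sumℕ-cong λ i → disagree-refl (lookup a i)) (sumℕ-zero m))
hamming-lower {a = a} {b} (step {w = c} (i , _ , agree) w) = ℕₚ.≤-trans
  (sumℕ-≤suc _ (λ j → disagree (lookup c j) (lookup b j)) i
    (ℕₚ.≤-trans (disagree≤1 (lookup a i) (lookup b i)) (s≤s z≤n))
    λ j j≢i → cong (λ s → disagree s (lookup b j)) (agree j j≢i))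
  (s≤s (hamming-lower w))

hamming-walk : ∀ k (a b : Vec Bool m) → hamming a b ≡ k → Walk QAdj a b k
hamming-walk zero a b eq =
  subst (λ c → Walk QAdj a c 0) (lookup-ext λ i → disagree≡0 (lookup a i) (lookup b i) (sumℕ≡0 _ eq i)) here
hamming-walk (suc k) a b eq with sumℕ>0 (λ i → disagree (lookup a i) (lookup b i)) eq
... | i , ≢0 = step
  (i , (λ same → a≢b (trans same (lookup∘update i a (lookup b i))))
     , λ j j≢i → sym (lookup∘update′ j≢i a (lookup b i)))
  (hamming-walk k (a [ i ]≔ lookup b i) b (ℕₚ.suc-injective (trans (sym one-less) eq)))
  where
  a≢b = disagree≢0 (lookup a i) (lookup b i) ≢0
  one-less : hamming a b ≡ suc (hamming (a [ i ]≔ lookup b i) b)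
  one-less = sumℕ-suc _ _ i
    (trans (≢⇒disagree _ _ a≢b) (cong suc (sym (trans (cong (λ s → disagree s (lookup b i)) (lookup∘update i a (lookup b i)))
                                                      (disagree-refl (lookup b i))))))
    λ j j≢i → cong (λ s → disagree s (lookup b j)) (sym (lookup∘update′ j≢i a (lookup b i)))

Dist-unique : {V : Set} {Adj : V → V → Set} {u w : V} → ∀ {j k} → Dist Adj u w j → Dist Adj u w k → j ≡ k
Dist-unique (p , p-min) (q , q-min) = ℕₚ.≤-antisym (p-min _ q) (q-min _ p)

hamming-Dist : (a b : Vec Bool m) → Dist QAdj a b (hamming a b)
hamming-Dist a b = hamming-walk _ a b refl , λ _ → hamming-lower

-- Arithmetic of unit steps, and least witnesses.

xor-involutive : ∀ a b → a xor (a xor b) ≡ b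
xor-involutive true true = refl
xor-involutive true false = refl
xor-involutive false b = refl

sign-grad-on : ∀ b → sign b ℤ.* 1ℤ ℤ.- sign b ℤ.* 0ℤ ≡ sign b
sign-grad-on true = refl
sign-grad-on false = refl

sign-grad-off : ∀ b → sign b ℤ.* 0ℤ ℤ.- sign b ℤ.* 1ℤ ≡ sign (not b)
sign-grad-off true = refl
sign-grad-off false = refl

∣sign∣ : ∀ b → ∣ sign b ∣ ≡ 1
∣sign∣ true = refl
∣sign∣ false = refl

sign-of : ∀ r → ∣ r ∣ ≢ 0 → ∃ λ b → 0ℤ ℤ.< sign b ℤ.* r
sign-of (+ zero) ≢0 = contradiction refl ≢0
sign-of (+ suc r) _ = true , +<+ (s≤s z≤n)
sign-of -[1+ r ] _ = false , +<+ (s≤s z≤n)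

∣∣-step : ∀ b r → 0ℤ ℤ.< sign b ℤ.* r → ∣ r ∣ ≡ suc ∣ r ℤ.- sign b ∣
∣∣-step true (+ suc r) _ = refl
∣∣-step true (+ zero) (+<+ ())
∣∣-step true -[1+ r ] ()
∣∣-step false -[1+ zero ] _ = refl
∣∣-step false -[1+ suc r ] _ = refl
∣∣-step false (+ zero) (+<+ ())
∣∣-step false (+ suc r) ()

∣∣-lipschitz : ∀ b r → ∣ r ∣ ≤ suc ∣ r ℤ.- sign b ∣
∣∣-lipschitz b r = subst₂ _≤_ (cong ∣_∣ (restore r (sign b))) (trans (cong (∣ r ℤ.- sign b ∣ ℕ.+_) (∣sign∣ b)) (ℕₚ.+-comm _ 1))
  (ℤₚ.∣i+j∣≤∣i∣+∣j∣ (r ℤ.- sign b) (sign b))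
  where
  restore : ∀ a b → a ℤ.- b ℤ.+ b ≡ a
  restore = solve-∀

least : {P : ℕ → Set} → Decidable P → ∀ k → P k → ∃ λ m → P m × (∀ j → j < m → ¬ P j)
least {P} P? k pk = search k 0 (subst P (sym (ℕₚ.+-identityʳ k)) pk) λ _ ()
  where
  search : ∀ k m → P (k ℕ.+ m) → (∀ j → j < m → ¬ P j) → ∃ λ m → P m × (∀ j → j < m → ¬ P j)
  search zero m pm below = m , pm , below
  search (suc k) m pk below with P? m
  ... | yes pm = m , pm , below
  ... | no ¬pm = search k (suc m) (subst P (sym (ℕₚ.+-suc k m)) pk) below′
    where
    below′ : ∀ j → j < suc m → ¬ P j
    below′ j j<sm with ℕₚ.m≤n⇒m<n∨m≡n (ℕₚ.≤-pred j<sm)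
    ... | inj₁ j<m = below j j<m
    ... | inj₂ refl = ¬pm

sumℕ≥⇒ones : (f : Fin k → ℕ) → (∀ i → f i ≤ 1) → k ≤ sumℕ f → ∀ i → f i ≡ 1
sumℕ≥⇒ones {suc k} f f≤1 bound = λ
  { zero → ℕₚ.≤-antisym (f≤1 zero) (ℕₚ.+-cancelʳ-≤ k _ _ (ℕₚ.≤-trans bound (ℕₚ.+-monoʳ-≤ (f zero) rest≤)))
  ; (suc i) → sumℕ≥⇒ones (f ∘ suc) (f≤1 ∘ suc) (ℕₚ.≤-pred (ℕₚ.≤-trans bound (ℕₚ.+-monoˡ-≤ _ (f≤1 zero)))) i }
  where
  rest≤ : sumℕ (f ∘ suc) ≤ k
  rest≤ = subst (sumℕ (f ∘ suc) ≤_) (sumℕ-ones (λ (_ : Fin k) → 1) (λ _ → refl))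
                (sumℕ-mono (f ∘ suc) (λ _ → 1) (f≤1 ∘ suc))

∣tabulate∣ : (g : Fin k → Bool) → Sub.∣ tabulate g ∣ ≡ sumℕ (λ i → if g i then 1 else 0)
∣tabulate∣ {zero} g = refl
∣tabulate∣ {suc k} g with g zero
... | true = cong suc (∣tabulate∣ (g ∘ suc))
... | false = ∣tabulate∣ (g ∘ suc)

-- The sum is the length of the way from 0 to 1 through `h`. It is 1 exactly when `h` causes no
-- detour, which singles out the heights 0 and 1.
detour≥1 : ∀ h → 1 ≤ ∣ h ∣ ℕ.+ ∣ 1ℤ ℤ.- h ∣
detour≥1 (+ zero) = s≤s z≤n
detour≥1 (+ suc h) = s≤s z≤n
detour≥1 -[1+ h ] = s≤s z≤n

detour≡1 : ∀ h → ∣ h ∣ ℕ.+ ∣ 1ℤ ℤ.- h ∣ ≡ 1 → h ≡ 0ℤ ⊎ h ≡ 1ℤ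
detour≡1 (+ zero) _ = inj₁ refl
detour≡1 (+ suc zero) _ = inj₂ refl
detour≡1 (+ suc (suc h)) ()
detour≡1 -[1+ h ] eq = contradiction (trans (sym (ℕₚ.+-suc h _)) (ℕₚ.suc-injective eq)) λ ()

disagree≡∣bit-bit∣ : ∀ a b → disagree a b ≡ ∣ bit b ℤ.- bit a ∣
disagree≡∣bit-bit∣ true true = refl
disagree≡∣bit-bit∣ true false = refl
disagree≡∣bit-bit∣ false true = refl
disagree≡∣bit-bit∣ false false = refl

bit-≤ : ∀ a b → bit a ℤ.- bit b ℤ.≤ 0ℤ ⇔ a B.≤ b
bit-≤ true true = mk⇔ (λ _ → B.b≤b) (λ _ → ℤₚ.≤-refl)
bit-≤ true false = mk⇔ (λ { (+≤+ ()) }) λ ()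
bit-≤ false true = mk⇔ (λ _ → B.f≤t) (λ _ → -≤+)
bit-≤ false false = mk⇔ (λ _ → B.b≤b) (λ _ → ℤₚ.≤-refl)

xor≡false⇒≡ : ∀ a b → a xor b ≡ false → b ≡ a
xor≡false⇒≡ true true _ = refl
xor≡false⇒≡ false false _ = refl

-- Trees grown along admissible darts.

-- The tail map `t` decides where the tree lives: with `vert` in the graph, with `face` in its dual.
-- There are three uses: a spanning tree of the vertices, a dual tree that avoids its edges, and the
-- faces reachable from the infinite face without crossing a given cycle.
module Growth {m d : ℕ} (t : Fin d → Fin m) (α : Fin d → Fin d)
              (α-invol : ∀ x → α (α x) ≡ x) (α-nofix : ∀ x → α x ≢ x)
              (A : Fin d → Set) (r : Fin m) where

  -- The indices list the darts of the tree (both of every edge) and its nodes.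
  data Tree : List (Fin d) → List (Fin m) → Set where
    root : Tree [] (r ∷ [])
    grow : ∀ {ps ns} → Tree ps ns → ∀ x → A x → t x ∈ ns → t (α x) ∉ ns →
           Tree (x ∷ α x ∷ ps) (t (α x) ∷ ns)

  tree-ends : ∀ {ps ns} → Tree ps ns → ∀ {y} → y ∈ ps → t y ∈ ns × t (α y) ∈ ns
  tree-ends (grow T x a x∈ x∉) (here refl) = there x∈ , here refl
  tree-ends (grow {ns = ns} T x a x∈ x∉) (there (here refl)) =
    here refl , there (subst (λ z → t z ∈ ns) (sym (α-invol x)) x∈)
  tree-ends (grow T x a x∈ x∉) (there (there y∈)) with tree-ends T y∈
  ... | p , q = there p , there q

  tree-α : ∀ {ps ns} → Tree ps ns → ∀ {y} → y ∈ ps → α y ∈ ps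
  tree-α (grow T x a x∈ x∉) (here refl) = there (here refl)
  tree-α (grow T x a x∈ x∉) (there (here refl)) = here (α-invol x)
  tree-α (grow T x a x∈ x∉) (there (there y∈)) = there (there (tree-α T y∈))

  tree-unique : ∀ {ps ns} → Tree ps ns → Unique ps
  tree-unique root = []
  tree-unique (grow {ps} T x a x∈ x∉) =
    ∉⇒All≢ x-new ∷ ∉⇒All≢ αx-new ∷ tree-unique T
    where
    αx-new : α x ∉ ps
    αx-new p = x∉ (proj₁ (tree-ends T p))
    x-new : x ∉ α x ∷ ps
    x-new (here eq) = α-nofix x (sym eq)
    x-new (there p) = x∉ (proj₂ (tree-ends T p))

  nodes-unique : ∀ {ps ns} → Tree ps ns → Unique ns
  nodes-unique root = [] ∷ []
  nodes-unique (grow T x a x∈ x∉) = ∉⇒All≢ x∉ ∷ nodes-unique T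

  root∈ : ∀ {ps ns} → Tree ps ns → r ∈ ns
  root∈ root = here refl
  root∈ (grow T x a x∈ x∉) = there (root∈ T)

  tree-admissible : (∀ x → A x → A (α x)) → ∀ {ps ns} → Tree ps ns → ∀ {y} → y ∈ ps → A y
  tree-admissible A-α (grow T x a x∈ x∉) (here refl) = a
  tree-admissible A-α (grow T x a x∈ x∉) (there (here refl)) = A-α x a
  tree-admissible A-α (grow T x a x∈ x∉) (there (there y∈)) = tree-admissible A-α T y∈

  -- Nodes exceed edges by one; everything is doubled because both darts of an edge are listed, as
  -- in `euler`.
  tree-length : ∀ {ps ns} → Tree ps ns → length ps ℕ.+ 2 ≡ 2 ℕ.* length ns
  tree-length root = refl
  tree-length (grow {ns = ns} T x a x∈ x∉) =
    trans (cong (2 ℕ.+_) (tree-length T)) (sym (ℕₚ.*-suc 2 (length ns)))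

  Closed : List (Fin m) → Set
  Closed ns = ∀ x → A x → t x ∈ ns → t (α x) ∈ ns

  spanning : (∀ x → Dec (A x)) → ∃₂ λ ps ns → Tree ps ns × Closed ns
  spanning A? = extend m root (ℕₚ.m≤n+m m 1)
    where
    -- The fuel `j` bounds the number of nodes still missing. At `zero` the node list is complete,
    -- so no dart can lead out of it.
    extend : ∀ j {ps ns} → Tree ps ns → m ≤ length ns ℕ.+ j → ∃₂ λ ps ns → Tree ps ns × Closed ns
    extend j {ps} {ns} T m≤
      with Finₚ.any? (λ x → A? x ×-dec _∈?_ _≟_ (t x) ns ×-dec ¬? (_∈?_ _≟_ (t (α x)) ns))
    ... | no stuck = ps , ns , T , is-closed
      where
      is-closed : Closed ns
      is-closed x a x∈ with _∈?_ _≟_ (t (α x)) ns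
      ... | yes p = p
      ... | no ¬p = contradiction (x , a , x∈ , ¬p) stuck
    extend zero {ps} {ns} T m≤ | yes (x , a , x∈ , x∉) =
      contradiction (unique-complete (nodes-unique T) (subst (m ≤_) (ℕₚ.+-identityʳ _) m≤) _) x∉
    extend (suc j) {ps} {ns} T m≤ | yes (x , a , x∈ , x∉) =
      extend j (grow T x a x∈ x∉) (subst (m ≤_) (ℕₚ.+-suc (length ns) j) m≤)

  -- Subtracting `ω x` at the new node makes the value at the tail of `x` minus the value at its
  -- other end equal to `ω x`, the convention of `grad`.
  integrate : ∀ {ps ns} → Tree ps ns → (Fin d → ℤ) → Fin m → ℤ
  integrate root ω f = 0ℤ
  integrate (grow T x _ _ _) ω f =
    if ⌊ f ≟ t (α x) ⌋ then integrate T ω (t x) ℤ.- ω x else integrate T ω f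

  integrate-old : ∀ {ps ns} (T : Tree ps ns) x a x∈ x∉ ω f → f ∈ ns →
                  integrate (grow T x a x∈ x∉) ω f ≡ integrate T ω f
  integrate-old T x a x∈ x∉ ω f f∈ with f ≟ t (α x)
  ... | yes refl = contradiction f∈ x∉
  ... | no _ = refl

  integrate-new : ∀ {ps ns} (T : Tree ps ns) x a x∈ x∉ ω →
                  integrate (grow T x a x∈ x∉) ω (t (α x)) ≡ integrate T ω (t x) ℤ.- ω x
  integrate-new T x a x∈ x∉ ω with t (α x) ≟ t (α x)
  ... | yes _ = refl
  ... | no ¬p = contradiction refl ¬p

  integrate-root : ∀ {ps ns} (T : Tree ps ns) ω → integrate T ω r ≡ 0ℤ
  integrate-root root ω = refl
  integrate-root (grow T x a x∈ x∉) ω = trans (integrate-old T x a x∈ x∉ ω r (root∈ T)) (integrate-root T ω)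

  integrate-diff : ∀ {ps ns} (T : Tree ps ns) ω → (∀ x → ω (α x) ≡ ℤ.- ω x) → ∀ {y} → y ∈ ps →
                   integrate T ω (t y) ℤ.- integrate T ω (t (α y)) ≡ ω y
  integrate-diff (grow T x a x∈ x∉) ω anti (here refl) =
    trans (cong₂ ℤ._-_ (integrate-old T x a x∈ x∉ ω _ x∈) (integrate-new T x a x∈ x∉ ω))
          (cancel (integrate T ω (t x)) (ω x))
    where
    cancel : ∀ a b → a ℤ.- (a ℤ.- b) ≡ b
    cancel = solve-∀
  integrate-diff (grow T x a x∈ x∉) ω anti (there (here refl)) =
    trans (cong₂ ℤ._-_ (integrate-new T x a x∈ x∉ ω)
                       (trans (cong (integrate (grow T x a x∈ x∉) ω ∘ t) (α-invol x))
                              (integrate-old T x a x∈ x∉ ω _ x∈)))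
          (trans (cancel (integrate T ω (t x)) (ω x)) (sym (anti x)))
    where
    cancel : ∀ a b → a ℤ.- b ℤ.- a ≡ ℤ.- b
    cancel = solve-∀
  integrate-diff (grow T x a x∈ x∉) ω anti {y} (there (there y∈)) =
    trans (cong₂ ℤ._-_ (integrate-old T x a x∈ x∉ ω _ (proj₁ (tree-ends T y∈)))
                       (integrate-old T x a x∈ x∉ ω _ (proj₂ (tree-ends T y∈))))
          (integrate-diff T ω anti y∈)

-- Flows and potentials on a plane map.

module Plane {d v n : ℕ} (G : PlaneGraph d v n) where
  open PlaneGraph G

  vert-σ : ∀ x → vert (σ x) ≡ vert x
  vert-σ x = sym (Equivalence.from (vert-orbit x (σ x)) (1 , refl))

  face-σ : ∀ x → face (σ x) ≡ face (α x)
  face-σ x = sym (Equivalence.from (face-orbit (α x) (σ x)) (1 , cong σ (α-invol x)))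

  dart-induction : (P : Fin d → Set) → (∀ x → P x → P (α x)) → (∀ x → P x → P (σ x)) →
                   ∀ {x} → P x → ∀ y → P y
  dart-induction P P-α P-σ {x} px y = walk (proj₂ (map-connected x y)) px
    where
    walk : ∀ {x y k} → Walk (λ a b → (b ≡ α a) ⊎ (b ≡ σ a)) x y k → P x → P y
    walk here p = p
    walk (step (inj₁ refl) w) p = walk w (P-α _ p)
    walk (step (inj₂ refl) w) p = walk w (P-σ _ p)

  grad : (Fin (suc n) → ℤ) → Fin d → ℤ
  grad z x = z (face x) ℤ.- z (face (α x))

  at : Fin v → (Fin d → ℤ) → Fin d → ℤ
  at u ω y = if ⌊ vert y ≟ u ⌋ then ω y else 0ℤ

  Flow : (Fin d → ℤ) → Set
  Flow ω = ∀ u → sum (at u ω) ≡ 0ℤ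

  Antisymmetric : (Fin d → ℤ) → Set
  Antisymmetric ω = ∀ x → ω (α x) ≡ ℤ.- ω x

  at-on : ∀ u ω y → vert y ≡ u → at u ω y ≡ ω y
  at-on u ω y eq with vert y ≟ u
  ... | yes _ = refl
  ... | no y≢u = contradiction eq y≢u

  at-zero : ∀ u ω y → (vert y ≡ u → ω y ≡ 0ℤ) → at u ω y ≡ 0ℤ
  at-zero u ω y ω≡0 with vert y ≟ u
  ... | yes eq = ω≡0 eq
  ... | no _ = refl

  at-sub : ∀ u ω ω′ y → at u (λ x → ω x ℤ.- ω′ x) y ≡ at u ω y ℤ.- at u ω′ y
  at-sub u ω ω′ y with vert y ≟ u
  ... | yes _ = refl
  ... | no _ = refl

  sum-at-sub : ∀ u ω ω′ → sum (at u (λ x → ω x ℤ.- ω′ x)) ≡ sum (at u ω) ℤ.- sum (at u ω′)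
  sum-at-sub u ω ω′ = trans (sum-cong-≗ (at-sub u ω ω′)) (sum-sub (at u ω) (at u ω′))

  grad-antisymmetric : ∀ z → Antisymmetric (grad z)
  grad-antisymmetric z x =
    trans (cong (λ y → z (face (α x)) ℤ.- z (face y)) (α-invol x)) (swap (z (face (α x))) (z (face x)))
    where
    swap : ∀ a b → a ℤ.- b ≡ ℤ.- (b ℤ.- a)
    swap = solve-∀

  -- The sum around a vertex telescopes, because σ turns the right face of a dart into its left one.
  grad-flow : ∀ z → Flow (grad z)
  grad-flow z u =
    trans (sum-at-sub u (z ∘ face) (z ∘ face ∘ α))
          (trans (cong (λ s → sum right ℤ.- s) (trans (sum-cong-≗ left≗) (sym (sum-permute right σ-perm))))
                 (ℤₚ.+-inverseʳ (sum right)))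
    where
    right = at u (z ∘ face)
    σ-perm = permutation σ σ⁻¹ σσ⁻¹ σ⁻¹σ
    left≗ : ∀ y → at u (z ∘ face ∘ α) y ≡ right (σ y)
    left≗ y = cong₂ (λ w f → if ⌊ w ≟ u ⌋ then z f else 0ℤ) (sym (vert-σ y)) (sym (face-σ y))

  flow-sub : ∀ {ω ω′} → Flow ω → Flow ω′ → Flow (λ x → ω x ℤ.- ω′ x)
  flow-sub {ω} {ω′} fl fl′ u = trans (sum-at-sub u ω ω′) (cong₂ ℤ._-_ (fl u) (fl′ u))

  -- The dual graph is connected because the map is: `α` crosses an edge, and by `face-σ` a `σ`-move
  -- ends in the same face as an `α`-move.
  grad≡0⇒≡0 : ∀ z → (∀ x → grad z x ≡ 0ℤ) → z zero ≡ 0ℤ → ∀ f → z f ≡ 0ℤ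
  grad≡0⇒≡0 z flat z0 f =
    subst (λ f → z f ≡ 0ℤ) (proj₂ (face-surj f))
      (dart-induction (λ x → z (face x) ≡ 0ℤ) cross-α (λ x p → trans (cong z (face-σ x)) (cross-α x p))
        (trans (cong z (proj₂ (face-surj zero))) z0) (proj₁ (face-surj f)))
    where
    cross-α : ∀ x → z (face x) ≡ 0ℤ → z (face (α x)) ≡ 0ℤ
    cross-α x p = trans (sym (ℤₚ.i-j≡0⇒i≡j _ _ (flat x))) p

  grad-injective : ∀ z z′ → (∀ x → grad z x ≡ grad z′ x) → z zero ≡ z′ zero → ∀ f → z f ≡ z′ f
  grad-injective z z′ eq eq₀ f =
    ℤₚ.i-j≡0⇒i≡j _ _ (grad≡0⇒≡0 (λ f → z f ℤ.- z′ f)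
      (λ x → trans (sub-interchange (z (face x)) _ (z (face (α x))) _)
                   (trans (cong (λ s → s ℤ.- grad z′ x) (eq x)) (ℤₚ.+-inverseʳ (grad z′ x))))
      (trans (cong (λ s → s ℤ.- z′ zero) eq₀) (ℤₚ.+-inverseʳ (z′ zero))) f)

  private
    x₀ : Fin d
    x₀ = proj₁ (face-surj zero)

  module VertexTree = Growth vert α α-invol α-nofix (λ _ → ⊤) (vert x₀)

  -- The node grown last is a leaf, so `α x` is the only dart at it that can carry flow.
  -- Conservation kills it, antisymmetry kills `x`, and the smaller tree remains.
  tree-flow≡0 : ∀ {ps ns} → VertexTree.Tree ps ns → ∀ ω → Antisymmetric ω → Flow ω →
                (∀ y → y ∉ ps → ω y ≡ 0ℤ) → ∀ y → ω y ≡ 0ℤ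
  tree-flow≡0 VertexTree.root ω anti fl off y = off y λ ()
  tree-flow≡0 (VertexTree.grow {ps} {ns} T x _ x∈ x∉) ω anti fl off =
    tree-flow≡0 T ω anti fl off′
    where
    ω-leaf : ω (α x) ≡ 0ℤ
    ω-leaf = trans (sym (trans (sum-single (at (vert (α x)) ω) (α x) others) (at-on _ ω (α x) refl))) (fl (vert (α x)))
      where
      others : ∀ y → y ≢ α x → at (vert (α x)) ω y ≡ 0ℤ
      others y y≢ = at-zero _ ω y λ eq → off y λ
        { (here refl) → x∉ (subst (_∈ ns) eq x∈)
        ; (there (here y≡)) → y≢ y≡
        ; (there (there y∈)) → x∉ (subst (_∈ ns) eq (proj₁ (VertexTree.tree-ends T y∈))) }
    off′ : ∀ y → y ∉ ps → ω y ≡ 0ℤ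
    off′ y y∉ with y ≟ α x | y ≟ x
    ... | yes refl | _ = ω-leaf
    ... | no _ | yes refl = trans (sym (ℤₚ.neg-involutive _)) (cong ℤ.-_ (trans (sym (anti x)) ω-leaf))
    ... | no ≢αx | no ≢x = off y λ { (here p) → ≢x p ; (there (here p)) → ≢αx p ; (there (there p)) → y∉ p }

  private
    abstract
      vt : ∃₂ λ ps ns → VertexTree.Tree ps ns × VertexTree.Closed ns
      vt = VertexTree.spanning (λ _ → yes tt)
    vps = proj₁ vt
    vns = proj₁ (proj₂ vt)
    VT = proj₁ (proj₂ (proj₂ vt))

    vt-all : ∀ u → u ∈ vns
    vt-all u = subst (_∈ vns) (proj₂ (vert-surj u))
      (dart-induction (λ x → vert x ∈ vns) (λ x → proj₂ (proj₂ (proj₂ vt)) x tt)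
        (λ x → subst (_∈ vns) (sym (vert-σ x))) (VertexTree.root∈ VT) (proj₁ (vert-surj u)))

    Cotree : Fin d → Set
    Cotree x = x ∉ vps

  module FaceTree = Growth face α α-invol α-nofix Cotree zero

  private
    cotree-α : ∀ x → Cotree x → Cotree (α x)
    cotree-α x x∉ αx∈ = x∉ (subst (_∈ vps) (α-invol x) (VertexTree.tree-α VT αx∈))

    abstract
      ft : ∃₂ λ ps ns → FaceTree.Tree ps ns × FaceTree.Closed ns
      ft = FaceTree.spanning (λ x → ¬? (_∈?_ _≟_ x vps))
    fps = proj₁ ft
    fns = proj₁ (proj₂ ft)
    FT = proj₁ (proj₂ (proj₂ ft))

    unreached : Fin (suc n) → ℤ
    unreached f = if ⌊ _∈?_ _≟_ f fns ⌋ then 0ℤ else 1ℤ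

    unreached-∈ : ∀ {f} → f ∈ fns → unreached f ≡ 0ℤ
    unreached-∈ {f} f∈ with _∈?_ _≟_ f fns
    ... | yes _ = refl
    ... | no f∉ = contradiction f∈ f∉

    unreached-∉ : ∀ {f} → f ∉ fns → unreached f ≡ 1ℤ
    unreached-∉ {f} f∉ with _∈?_ _≟_ f fns
    ... | yes f∈ = contradiction f∈ f∉
    ... | no _ = refl

    -- The gradient of the indicator of the unreached faces is a flow carried by the vertex tree.
    ft-all : ∀ f → f ∈ fns
    ft-all f with _∈?_ _≟_ f fns
    ... | yes f∈ = f∈
    ... | no f∉ = contradiction (trans (sym (unreached-∉ f∉)) (unreached≡0 f)) λ ()
      where
      flat : ∀ y → y ∉ vps → grad unreached y ≡ 0ℤ
      flat y y∉ with _∈?_ _≟_ (face y) fns | _∈?_ _≟_ (face (α y)) fns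
      ... | yes _ | yes _ = refl
      ... | no _ | no _ = refl
      ... | yes p | no ¬q = contradiction (proj₂ (proj₂ (proj₂ ft)) y y∉ p) ¬q
      ... | no ¬p | yes q =
        contradiction (subst (λ z → face z ∈ fns) (α-invol y) (proj₂ (proj₂ (proj₂ ft)) (α y) (cotree-α y y∉) q)) ¬p
      unreached≡0 : ∀ f → unreached f ≡ 0ℤ
      unreached≡0 = grad≡0⇒≡0 unreached
        (tree-flow≡0 VT (grad unreached) (grad-antisymmetric unreached) (grad-flow unreached) flat)
        (unreached-∈ (FaceTree.root∈ FT))

    -- The two trees share no dart and have at least `2v - 2` and `2(n + 1) - 2` darts, which add up
    -- to `d` by `euler`. This is where genus 0 enters: no dart is left over that could carry a
    -- circulation without potential.
    tree∪cotree : ∀ x → x ∈ vps ++ fps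
    tree∪cotree = unique-complete
      (++⁺ (VertexTree.tree-unique VT) (FaceTree.tree-unique FT)
        λ { (p , q) → FaceTree.tree-admissible cotree-α FT q p })
      (subst (d ≤_) (sym (length-++ vps)) (ℕₚ.+-cancelʳ-≤ 4 _ _ enough))
      where
      open ℕₚ.≤-Reasoning
      enough : d ℕ.+ 4 ≤ length vps ℕ.+ length fps ℕ.+ 4
      enough = begin
        d ℕ.+ 4                                            ≡⟨ sym euler ⟩
        2 ℕ.* v ℕ.+ 2 ℕ.* suc n                            ≤⟨ ℕₚ.+-mono-≤ (ℕₚ.*-monoʳ-≤ 2 (complete-length≥ vns vt-all))
                                                                          (ℕₚ.*-monoʳ-≤ 2 (complete-length≥ fns ft-all)) ⟩
        2 ℕ.* length vns ℕ.+ 2 ℕ.* length fns              ≡⟨ sym (cong₂ ℕ._+_ (VertexTree.tree-length VT) (FaceTree.tree-length FT)) ⟩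
        (length vps ℕ.+ 2) ℕ.+ (length fps ℕ.+ 2)          ≡⟨ regroup (length vps) (length fps) ⟩
        length vps ℕ.+ length fps ℕ.+ 4                    ∎
        where
        regroup : ∀ a b → (a ℕ.+ 2) ℕ.+ (b ℕ.+ 2) ≡ a ℕ.+ b ℕ.+ 4
        regroup a b = trans (ℕₚ.+-assoc a 2 _) (trans (cong (a ℕ.+_) (trans (sym (ℕₚ.+-assoc 2 b 2))
          (trans (cong (ℕ._+ 2) (ℕₚ.+-comm 2 b)) (ℕₚ.+-assoc b 2 2)))) (sym (ℕₚ.+-assoc a b 4)))

  private
    integral : (Fin d → ℤ) → Fin (suc n) → ℤ
    integral ω = FaceTree.integrate FT ω

    integral-zero : ∀ ω → integral ω zero ≡ 0ℤ
    integral-zero ω = FaceTree.integrate-root FT ω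

    -- The integral along the dual tree is right on the darts of that tree. All other darts belong
    -- to the vertex tree, so the error is a flow carried by a tree and vanishes.
    grad-integral : ∀ ω → Antisymmetric ω → Flow ω → ∀ x → grad (integral ω) x ≡ ω x
    grad-integral ω anti fl x = sym (ℤₚ.i-j≡0⇒i≡j _ _
      (tree-flow≡0 VT rest rest-anti (flow-sub fl (grad-flow (integral ω))) off x))
      where
      rest : Fin d → ℤ
      rest x = ω x ℤ.- grad (integral ω) x
      rest-anti : Antisymmetric rest
      rest-anti x = trans (cong₂ ℤ._-_ (anti x) (grad-antisymmetric (integral ω) x)) (neg-sub (ω x) _)
        where
        neg-sub : ∀ a b → ℤ.- a ℤ.- ℤ.- b ≡ ℤ.- (a ℤ.- b)
        neg-sub = solve-∀
      off : ∀ y → y ∉ vps → rest y ≡ 0ℤ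
      off y y∉ with ∈-++⁻ vps (tree∪cotree y)
      ... | inj₁ y∈ = contradiction y∈ y∉
      ... | inj₂ y∈ = trans (cong (λ s → ω y ℤ.- s) (FaceTree.integrate-diff FT ω anti y∈)) (ℤₚ.+-inverseʳ (ω y))

  abstract
    potential : (Fin d → ℤ) → Fin (suc n) → ℤ
    potential = integral

    potential-zero : ∀ ω → potential ω zero ≡ 0ℤ
    potential-zero = integral-zero

    grad-potential : ∀ ω → Antisymmetric ω → Flow ω → ∀ x → grad (potential ω) x ≡ ω x
    grad-potential = grad-integral

-- Perfect matchings as flows and heights.

module Matchings {d v n : ℕ} (G : PlaneGraph d v n) (col : Fin v → Bool)
                 (proper : ProperColoring G col) (elementary : Elementary G) (i₀ : Fin n)
                 (M₀ : Subset d) (pm₀ : IsPM G M₀) where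
  open PlaneGraph G
  open Plane G

  colour : Fin d → Bool
  colour x = col (vert x)

  colour-α : ∀ x → colour (α x) ≡ not (colour x)
  colour-α x with colour x | colour (α x) | proper x
  ... | true | true | ≢ = contradiction refl ≢
  ... | true | false | _ = refl
  ... | false | true | _ = refl
  ... | false | false | ≢ = contradiction refl ≢

  pm-α : ∀ {M} → IsPM G M → ∀ x → lookup M (α x) ≡ lookup M x
  pm-α {M} (closed-α , _) x with lookup M x in eq | lookup M (α x) in eq′
  ... | true | true = refl
  ... | false | false = refl
  ... | true | false = contradiction (trans (sym (∈⇒lookup (closed-α x (lookup⇒∈ eq)))) eq′) λ ()
  ... | false | true = contradiction (trans (sym (∈⇒lookup (subst (Sub._∈ M) (α-invol x) (closed-α (α x) (lookup⇒∈ eq′))))) eq) λ ()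

  mate : ∀ {M} → IsPM G M → ∀ u →
         ∃ λ x → lookup M x ≡ true × vert x ≡ u × (∀ y → lookup M y ≡ true → vert y ≡ u → y ≡ x)
  mate (_ , _ , cover) u with cover u tt
  ... | x , x∈ , vx , unique = x , ∈⇒lookup x∈ , vx , λ y My → unique y (lookup⇒∈ My)

  pm-unique : ∀ {M} → IsPM G M → ∀ {x y} → lookup M x ≡ true → lookup M y ≡ true → vert x ≡ vert y → x ≡ y
  pm-unique pm {x} {y} Mx My eq with mate pm (vert y)
  ... | z , _ , _ , unique = trans (unique x Mx eq) (sym (unique y My refl))

  degree : Subset d → Fin v → ℤ
  degree M u = sum (at u (bit ∘ lookup M))

  pm-degree : ∀ {M} → IsPM G M → ∀ u → degree M u ≡ 1ℤ
  pm-degree {M} pm u with mate pm u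
  ... | x , Mx , vx , unique =
    trans (sum-single (at u (bit ∘ lookup M)) x λ y y≢x → at-zero u (bit ∘ lookup M) y λ vy → off y y≢x vy)
          (trans (at-on u (bit ∘ lookup M) x vx) (cong bit Mx))
    where
    off : ∀ y → y ≢ x → vert y ≡ u → bit (lookup M y) ≡ 0ℤ
    off y y≢x vy with lookup M y in My
    ... | true = contradiction (unique y My vy) y≢x
    ... | false = refl

  degree-pm : ∀ {M} → (∀ x → lookup M (α x) ≡ lookup M x) → (∀ u → degree M u ≡ 1ℤ) → IsPM G M
  degree-pm {M} M-α deg = (λ x x∈ → lookup⇒∈ (trans (M-α x) (∈⇒lookup x∈))) , (λ _ _ → tt) , cover
    where
    local : Fin v → Fin d → Bool
    local u y = if ⌊ vert y ≟ u ⌋ then lookup M y else false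
    at≗ : ∀ u y → bit (local u y) ≡ at u (bit ∘ lookup M) y
    at≗ u y with vert y ≟ u
    ... | yes _ = refl
    ... | no _ = refl
    local-true : ∀ u y → local u y ≡ true → lookup M y ≡ true × vert y ≡ u
    local-true u y eq with vert y ≟ u
    ... | yes vy = eq , vy
    local-on : ∀ u y → lookup M y ≡ true → vert y ≡ u → local u y ≡ true
    local-on u y My vy with vert y ≟ u
    ... | yes _ = My
    ... | no ≢ = contradiction vy ≢
    cover : ∀ u → ⊤ → ∃ λ x → x Sub.∈ M × vert x ≡ u × (∀ y → y Sub.∈ M → vert y ≡ u → y ≡ x)
    cover u _ with sum-bit≡1 (local u) (trans (sum-cong-≗ (at≗ u)) (deg u))
    ... | x , lx , unique with local-true u x lx
    ...   | Mx , vx = x , lookup⇒∈ Mx , vx , λ y y∈ vy → unique y (local-on u y (∈⇒lookup y∈) vy)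

  -- Membership is the same on both darts of an edge while the tail colours differ. The sign
  -- therefore turns a function on edges into an antisymmetric one on darts, and equal vertex
  -- degrees into conservation.
  change : Subset d → Subset d → Fin d → ℤ
  change M N x = sign (colour x) ℤ.* (bit (lookup N x) ℤ.- bit (lookup M x))

  change-antisymmetric : ∀ {M N} → (∀ x → lookup M (α x) ≡ lookup M x) → (∀ x → lookup N (α x) ≡ lookup N x) →
                         Antisymmetric (change M N)
  change-antisymmetric {M} {N} M-α N-α x = begin
    sign (colour (α x)) ℤ.* (bit (lookup N (α x)) ℤ.- bit (lookup M (α x)))
      ≡⟨ cong₂ (λ s t → s ℤ.* t) (trans (cong sign (colour-α x)) (sign-not (colour x)))
               (cong₂ (λ a b → bit a ℤ.- bit b) (N-α x) (M-α x)) ⟩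
    ℤ.- sign (colour x) ℤ.* (bit (lookup N x) ℤ.- bit (lookup M x))
      ≡⟨ sym (ℤₚ.neg-distribˡ-* (sign (colour x)) _) ⟩
    ℤ.- change M N x ∎
    where open ≡-Reasoning

  sum-change : ∀ M N u → sum (at u (change M N)) ≡ sign (col u) ℤ.* (degree N u ℤ.- degree M u)
  sum-change M N u = begin
    sum (at u (change M N))
      ≡⟨ sum-cong-≗ pointwise ⟩
    sum (λ y → sign (col u) ℤ.* (at u (bit ∘ lookup N) y ℤ.- at u (bit ∘ lookup M) y))
      ≡⟨ sum-scale (sign (col u)) (λ y → at u (bit ∘ lookup N) y ℤ.- at u (bit ∘ lookup M) y) ⟩
    sign (col u) ℤ.* sum (λ y → at u (bit ∘ lookup N) y ℤ.- at u (bit ∘ lookup M) y)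
      ≡⟨ cong (λ s → sign (col u) ℤ.* s) (sum-sub (at u (bit ∘ lookup N)) (at u (bit ∘ lookup M))) ⟩
    sign (col u) ℤ.* (degree N u ℤ.- degree M u) ∎
    where
    open ≡-Reasoning
    pointwise : ∀ y → at u (change M N) y ≡ sign (col u) ℤ.* (at u (bit ∘ lookup N) y ℤ.- at u (bit ∘ lookup M) y)
    pointwise y with vert y ≟ u
    ... | yes refl = refl
    ... | no _ = sym (ℤₚ.*-zeroʳ (sign (col u)))

  change-flow : ∀ {M N} → IsPM G M → IsPM G N → Flow (change M N)
  change-flow {M} {N} pmM pmN u =
    trans (sum-change M N u)
          (trans (cong₂ (λ a b → sign (col u) ℤ.* (a ℤ.- b)) (pm-degree pmN u) (pm-degree pmM u))
                 (ℤₚ.*-zeroʳ (sign (col u))))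

  -- At a vertex `u` all darts have the same tail colour, so the flow condition says precisely that
  -- `N` has the same degree as `M` there.
  flow-pm : ∀ {M N} → IsPM G M → (∀ x → lookup N (α x) ≡ lookup N x) → Flow (change M N) → IsPM G N
  flow-pm {M} {N} pmM N-α fl = degree-pm N-α λ u →
    trans (sign-cancel (col u) (trans (sym (sum-change M N u)) (fl u))) (pm-degree pmM u)

  change≡0 : ∀ M N x → change M N x ≡ 0ℤ → lookup N x ≡ lookup M x
  change≡0 M N x eq = bit-injective (sign-cancel (colour x) eq)

  change-trans : ∀ L M N x → change L M x ℤ.+ change M N x ≡ change L N x
  change-trans L M N x =
    telescope (sign (colour x)) (bit (lookup L x)) (bit (lookup M x)) (bit (lookup N x))
    where
    telescope : ∀ s a b c → s ℤ.* (b ℤ.- a) ℤ.+ s ℤ.* (c ℤ.- b) ≡ s ℤ.* (c ℤ.- a)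
    telescope = solve-∀

  height : Subset d → Fin (suc n) → ℤ
  height M = potential (change M₀ M)

  height-zero : ∀ M → height M zero ≡ 0ℤ
  height-zero M = potential-zero (change M₀ M)

  grad-height : ∀ {M} → IsPM G M → ∀ x → grad (height M) x ≡ change M₀ M x
  grad-height {M} pm = grad-potential (change M₀ M)
    (change-antisymmetric {M₀} {M} (pm-α pm₀) (pm-α pm)) (change-flow pm₀ pm)

  height-unique : ∀ {M} → IsPM G M → ∀ z → z zero ≡ 0ℤ → (∀ x → grad z x ≡ change M₀ M x) → ∀ f → height M f ≡ z f
  height-unique {M} pm z z0 eq = grad-injective (height M) z
    (λ x → trans (grad-height pm x) (sym (eq x))) (trans (height-zero M) (sym z0))

  rise : Subset d → Subset d → Fin (suc n) → ℤ
  rise M N f = height N f ℤ.- height M f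

  grad-rise : ∀ {M N} → IsPM G M → IsPM G N → ∀ x → grad (rise M N) x ≡ change M N x
  grad-rise {M} {N} pmM pmN x = begin
    grad (rise M N) x
      ≡⟨ sub-interchange (height N (face x)) (height M (face x)) (height N (face (α x))) (height M (face (α x))) ⟩
    grad (height N) x ℤ.- grad (height M) x
      ≡⟨ cong₂ ℤ._-_ (trans (grad-height pmN x) (sym (change-trans M₀ M N x))) (grad-height pmM x) ⟩
    change M₀ M x ℤ.+ change M N x ℤ.- change M₀ M x
      ≡⟨ cancel (change M₀ M x) (change M N x) ⟩
    change M N x ∎
    where
    open ≡-Reasoning
    cancel : ∀ a b → a ℤ.+ b ℤ.- a ≡ b
    cancel = solve-∀

  height-injective : ∀ {M N} → IsPM G M → IsPM G N → (∀ f → height M f ≡ height N f) → M ≡ N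
  height-injective {M} {N} pmM pmN eq = lookup-ext λ x → sym (change≡0 M N x
    (trans (sym (grad-rise pmM pmN x))
      (cong₂ ℤ._-_ (flat (face x)) (flat (face (α x))))))
    where
    flat : ∀ f → rise M N f ≡ 0ℤ
    flat f = trans (cong (λ s → s ℤ.- height M f) (sym (eq f))) (ℤₚ.+-inverseʳ (height M f))

  -- A dart in no perfect matching contradicts elementarity. If `x` were in all of them, a matching
  -- containing the next dart `σ x` would also contain `x` at the same vertex, so `σ` fixes `x`, and
  -- likewise `α x`. The map would then be a single edge, whose only face cannot be both `zero` and
  -- `suc i₀`.
  not-fixed : ∀ M x → ¬ (∀ N → IsPM G N → lookup N x ≡ lookup M x)
  not-fixed M x fixed with lookup M x | proj₂ elementary x
  ... | false | N , pmN , x∈ = contradiction (trans (sym (∈⇒lookup x∈)) (fixed N pmN)) λ ()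
  ... | true | _ = contradiction (trans (all-faces zero) (sym (all-faces (suc i₀)))) λ ()
    where
    σ-fixed : ∀ y → (∀ N → IsPM G N → lookup N y ≡ true) → σ y ≡ y
    σ-fixed y fixed-y with proj₂ elementary (σ y)
    ... | N , pmN , σy∈ = pm-unique pmN (∈⇒lookup σy∈) (fixed-y N pmN) (vert-σ y)
    σx = σ-fixed x fixed
    σαx = σ-fixed (α x) (λ N pmN → trans (pm-α pmN x) (fixed N pmN))
    two-darts : ∀ y → y ≡ x ⊎ y ≡ α x
    two-darts = dart-induction _
      (λ { _ (inj₁ refl) → inj₂ refl ; _ (inj₂ refl) → inj₁ (α-invol x) })
      (λ { _ (inj₁ refl) → inj₁ σx ; _ (inj₂ refl) → inj₂ σαx })
      (inj₁ {B = x ≡ α x} refl)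
    all-faces : ∀ f → f ≡ face x
    all-faces f with face-surj f
    ... | y , refl with two-darts y
    ...   | inj₁ refl = refl
    ...   | inj₂ refl = trans (sym (face-σ x)) (cong face σx)

  -- With one face on both sides, no height could jump across `x`, so every perfect matching would
  -- agree with `M₀` there.
  no-bridge : ∀ x → face x ≢ face (α x)
  no-bridge x eq = not-fixed M₀ x λ N pmN → change≡0 M₀ N x
    (trans (sym (grad-height pmN x))
      (trans (cong (λ f → height N (face x) ℤ.- height N f) (sym eq)) (ℤₚ.+-inverseʳ (height N (face x)))))

  -- Faces that can be raised or lowered.

  -- The weight at such a dart is already extreme in direction `b`: towards any other matching, its
  -- right face moves in that direction at most as far as its left face. A face without blocked
  -- darts is `Ready`.
  Blocked : Bool → Subset d → Fin d → Set
  Blocked b M x = colour x xor lookup M x ≡ not b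

  Ready : Bool → Subset d → Fin (suc n) → Set
  Ready b M f = ∀ x → face x ≡ f → colour x xor lookup M x ≡ b

  ready? : ∀ b M f → Dec (Ready b M f)
  ready? b M f = Finₚ.all? λ x → (face x ≟ f) →-dec (colour x xor lookup M x Bₚ.≟ b)

  blocked-rise : ∀ b {M N} → IsPM G M → IsPM G N → ∀ {x} → Blocked b M x →
                 sign b ℤ.* rise M N (face x) ℤ.≤ sign b ℤ.* rise M N (face (α x))
  blocked-rise b {M} {N} pmM pmN {x} bl = ℤₚ.i-j≤0⇒i≤j (subst (ℤ._≤ 0ℤ)
    (trans (cong (λ s → sign b ℤ.* s) (sym (grad-rise pmM pmN x))) (*-distribˡ-sub (sign b) _ _))
    (signed-change≤0 b (colour x) (lookup M x) (lookup N x) bl))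

  -- A cyclic chain of blocked darts would make every height difference constant along it, so its edges
  -- would be contained in all perfect matchings or in none.
  no-blocked-chain : ∀ b {M} → IsPM G M → (x : ℕ → Fin d) → (∀ k → Blocked b M (x k)) →
                     ¬ (∀ k → face (x (suc k)) ≡ face (α (x k)))
  no-blocked-chain b {M} pmM x bl link
    with Finₚ.pigeonhole (ℕₚ.n<1+n (suc n)) (face ∘ x ∘ toℕ)
  ... | i , j , i<j , eq = not-fixed M (x (toℕ i)) fixed
    where
    fixed : ∀ N → IsPM G N → lookup N (x (toℕ i)) ≡ lookup M (x (toℕ i))
    fixed N pmN = change≡0 M N (x (toℕ i)) (trans (sym (grad-rise pmM pmN (x (toℕ i))))
      (trans (cong (λ s → rise M N (face (x (toℕ i))) ℤ.- s) level)
             (ℤₚ.+-inverseʳ (rise M N (face (x (toℕ i)))))))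
      where
      r : ℕ → ℤ
      r k = sign b ℤ.* rise M N (face (x k))
      r-suc : ∀ k → r k ℤ.≤ r (suc k)
      r-suc k = subst (λ f → r k ℤ.≤ sign b ℤ.* rise M N f) (sym (link k)) (blocked-rise b pmM pmN (bl k))
      r-mono : ∀ {k l} → k ℕ.≤′ l → r k ℤ.≤ r l
      r-mono (ℕ.≤′-reflexive refl) = ℤₚ.≤-refl
      r-mono (ℕ.≤′-step k≤l) = ℤₚ.≤-trans (r-mono k≤l) (r-suc _)
      r-eq : r (suc (toℕ i)) ≡ r (toℕ i)
      r-eq = ℤₚ.≤-antisym (subst (λ f → r (suc (toℕ i)) ℤ.≤ sign b ℤ.* rise M N f) (sym eq) (r-mono (ℕₚ.≤⇒≤′ i<j)))
                          (r-suc (toℕ i))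
      level : rise M N (face (α (x (toℕ i)))) ≡ rise M N (face (x (toℕ i)))
      level = trans (cong (rise M N) (sym (link (toℕ i))))
        (sign-cancel b (trans (*-distribˡ-sub (sign b) _ _) (trans (cong (λ s → s ℤ.- r (toℕ i)) r-eq) (ℤₚ.+-inverseʳ (r (toℕ i))))))

  abstract
    -- If no face of `U` were ready, each would have a blocked dart leading to another face of `U`,
    -- and following these forever contradicts `no-blocked-chain`. By `blocked-rise`, the faces that
    -- still have to move in direction `b` form such a set `U`.
    ready-exists : ∀ b {M} → IsPM G M → {U : Fin (suc n) → Set} → Decidable U →
                   (∀ x → Blocked b M x → U (face x) → U (face (α x))) → ∃ U → ∃ λ f → U f × Ready b M f
    ready-exists b {M} pmM {U} U? step-U (f₀ , u₀) with Finₚ.any? (λ f → U? f ×-dec ready? b M f)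
    ... | yes found = found
    ... | no stuck = contradiction link (no-blocked-chain b pmM x bl)
      where
      blocking : ∀ f → U f → ∃ λ x → Blocked b M x × face x ≡ f
      blocking f u with Finₚ.any? (λ x → (colour x xor lookup M x Bₚ.≟ not b) ×-dec (face x ≟ f))
      ... | yes found = found
      ... | no none = contradiction (f , u , λ x fx →
        trans (Bₚ.¬-not (λ bl → none (x , bl , fx))) (Bₚ.not-involutive b)) stuck
      visit : ℕ → ∃ U
      dart-at : ∀ k → ∃ λ x → Blocked b M x × face x ≡ proj₁ (visit k)
      visit zero = f₀ , u₀
      visit (suc k) = face (α (proj₁ (dart-at k))) ,
        step-U _ (proj₁ (proj₂ (dart-at k))) (subst U (sym (proj₂ (proj₂ (dart-at k)))) (proj₂ (visit k)))
      dart-at k = blocking (proj₁ (visit k)) (proj₂ (visit k))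
      x : ℕ → Fin d
      x k = proj₁ (dart-at k)
      bl : ∀ k → Blocked b M (x k)
      bl k = proj₁ (proj₂ (dart-at k))
      link : ∀ k → face (x (suc k)) ≡ face (α (x k))
      link k = proj₂ (proj₂ (dart-at (suc k)))

  flip : Subset d → Fin (suc n) → Subset d
  flip M f = symDiff G M (boundary G f)

  lookup-boundary : ∀ f x → lookup (boundary G f) x ≡ ⌊ face x ≟ f ⌋ ∨ ⌊ face (α x) ≟ f ⌋
  lookup-boundary f = lookup∘tabulate _

  lookup-symDiff : ∀ M N x → lookup (symDiff G M N) x ≡ lookup M x xor lookup N x
  lookup-symDiff M N x = lookup-zipWith _xor_ x M N

  lookup-flip : ∀ M f x → lookup (flip M f) x ≡ lookup M x xor (⌊ face x ≟ f ⌋ ∨ ⌊ face (α x) ≟ f ⌋)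
  lookup-flip M f x = trans (lookup-symDiff M (boundary G f) x) (cong (λ s → lookup M x xor s) (lookup-boundary f x))

  symDiff-cancel : ∀ M N → symDiff G M (symDiff G M N) ≡ N
  symDiff-cancel M N = lookup-ext λ x →
    trans (lookup-symDiff M (symDiff G M N) x)
          (trans (cong (λ s → lookup M x xor s) (lookup-symDiff M N x)) (xor-involutive (lookup M x) (lookup N x)))

  on-boundary : ∀ {f x} → face x ≡ f → lookup (boundary G f) x ≡ true
  on-boundary {f} {x} eq = trans (lookup-boundary f x) (computed eq)
    where
    computed : face x ≡ f → ⌊ face x ≟ f ⌋ ∨ ⌊ face (α x) ≟ f ⌋ ≡ true
    computed eq with face x ≟ f
    ... | yes _ = refl
    ... | no ≢ = contradiction eq ≢

  off-boundary : ∀ {f x} → face x ≢ f → face (α x) ≢ f → lookup (boundary G f) x ≡ false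
  off-boundary {f} {x} p q = trans (lookup-boundary f x) (computed p q)
    where
    computed : face x ≢ f → face (α x) ≢ f → ⌊ face x ≟ f ⌋ ∨ ⌊ face (α x) ≟ f ⌋ ≡ false
    computed p q with face x ≟ f | face (α x) ≟ f
    ... | yes eq | _ = contradiction eq p
    ... | no _ | yes eq = contradiction eq q
    ... | no _ | no _ = refl

  on-boundary-α : ∀ {f x} → face (α x) ≡ f → lookup (boundary G f) x ≡ true
  on-boundary-α {f} {x} eq = trans (lookup-boundary f x) (computed eq)
    where
    computed : face (α x) ≡ f → ⌊ face x ≟ f ⌋ ∨ ⌊ face (α x) ≟ f ⌋ ≡ true
    computed eq with face x ≟ f | face (α x) ≟ f
    ... | yes _ | _ = refl
    ... | no _ | yes _ = refl
    ... | no _ | no ≢ = contradiction eq ≢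

  boundary-faces : ∀ f x → lookup (boundary G f) x ≡ true → face x ≡ f ⊎ face (α x) ≡ f
  boundary-faces f x eq with face x ≟ f | face (α x) ≟ f
  ... | yes p | _ = inj₁ p
  ... | no _ | yes q = inj₂ q
  ... | no p | no q = contradiction (trans (sym (off-boundary p q)) eq) λ ()

  boundary-α : ∀ f x → lookup (boundary G f) (α x) ≡ lookup (boundary G f) x
  boundary-α f x = begin
    lookup (boundary G f) (α x)                        ≡⟨ lookup-boundary f (α x) ⟩
    ⌊ face (α x) ≟ f ⌋ ∨ ⌊ face (α (α x)) ≟ f ⌋        ≡⟨ cong (λ y → ⌊ face (α x) ≟ f ⌋ ∨ ⌊ face y ≟ f ⌋) (α-invol x) ⟩
    ⌊ face (α x) ≟ f ⌋ ∨ ⌊ face x ≟ f ⌋                ≡⟨ Bₚ.∨-comm ⌊ face (α x) ≟ f ⌋ _ ⟩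
    ⌊ face x ≟ f ⌋ ∨ ⌊ face (α x) ≟ f ⌋                ≡⟨ sym (lookup-boundary f x) ⟩
    lookup (boundary G f) x                            ∎
    where open ≡-Reasoning

  spike : Bool → Fin (suc n) → Fin (suc n) → ℤ
  spike b f g = sign b ℤ.* indicator f g

  change-flip : ∀ b {M f} → IsPM G M → Ready b M f → ∀ x → change M (flip M f) x ≡ grad (spike b f) x
  change-flip b {M} {f} pmM ready x =
    trans (cong (λ m → sign (colour x) ℤ.* (bit m ℤ.- bit (lookup M x))) (lookup-flip M f x)) computed
    where
    opposite : ∀ c m → not c xor m ≡ b → c xor m ≡ not b
    opposite true true refl = refl
    opposite true false refl = refl
    opposite false true refl = refl
    opposite false false refl = refl
    computed : sign (colour x) ℤ.* (bit (lookup M x xor (⌊ face x ≟ f ⌋ ∨ ⌊ face (α x) ≟ f ⌋)) ℤ.- bit (lookup M x))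
             ≡ sign b ℤ.* bit ⌊ face x ≟ f ⌋ ℤ.- sign b ℤ.* bit ⌊ face (α x) ≟ f ⌋
    computed with face x ≟ f | face (α x) ≟ f
    ... | yes p | yes q = contradiction (trans p (sym q)) (no-bridge x)
    ... | yes p | no _ = trans (signed-toggle b (colour x) (lookup M x) (ready x p)) (sym (sign-grad-on b))
    ... | no _ | yes q = trans (signed-toggle (not b) (colour x) (lookup M x)
            (opposite (colour x) (lookup M x)
              (trans (sym (cong₂ _xor_ (colour-α x) (pm-α pmM x))) (ready (α x) q))))
            (sym (sign-grad-off b))
    ... | no _ | no _ = trans (cong (λ m → sign (colour x) ℤ.* (bit m ℤ.- bit (lookup M x))) (Bₚ.xor-identityʳ (lookup M x)))
            (trans (cong (λ s → sign (colour x) ℤ.* s) (ℤₚ.+-inverseʳ (bit (lookup M x))))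
                   (trans (ℤₚ.*-zeroʳ (sign (colour x))) (sym (ℤₚ.+-inverseʳ (sign b ℤ.* 0ℤ)))))

  abstract
    -- The change is the gradient of a spike, hence a flow, and flows preserve degrees. The shape of
    -- the facial walk does not enter.
    flip-pm : ∀ b {M f} → IsPM G M → Ready b M f → IsPM G (flip M f)
    flip-pm b {M} {f} pmM ready = flow-pm pmM flip-α
      λ u → trans (sum-cong-≗ (λ y → cong (λ s → if ⌊ vert y ≟ u ⌋ then s else 0ℤ) (change-flip b pmM ready y)))
                  (grad-flow (spike b f) u)
      where
      flip-α : ∀ x → lookup (flip M f) (α x) ≡ lookup (flip M f) x
      flip-α x = trans (lookup-symDiff M _ (α x))
        (trans (cong₂ _xor_ (pm-α pmM x) (boundary-α f x)) (sym (lookup-symDiff M _ x)))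

  -- Both sides have the gradient of the spike; the constant restores the value 0 on the infinite
  -- face. For `f = zero` it moves every finite face by one against the direction `b`.
  rise-flip : ∀ b {M f} → IsPM G M → Ready b M f → ∀ g → rise M (flip M f) g ≡ spike b f g ℤ.- spike b f zero
  rise-flip b {M} {f} pmM ready = grad-injective _ _
    (λ x → trans (grad-rise pmM (flip-pm b pmM ready) x)
                 (trans (change-flip b pmM ready x) (shift (spike b f (face x)) (spike b f (face (α x))) (spike b f zero))))
    (trans (trans (cong₂ ℤ._-_ (height-zero (flip M f)) (height-zero M)) refl) (sym (ℤₚ.+-inverseʳ (spike b f zero))))
    where
    shift : ∀ a b c → a ℤ.- b ≡ (a ℤ.- c) ℤ.- (b ℤ.- c)
    shift = solve-∀

  rise-zero : ∀ M N → rise M N zero ≡ 0ℤ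
  rise-zero M N = cong₂ ℤ._-_ (height-zero N) (height-zero M)

  rise-trans : ∀ L M N f → rise M N f ≡ rise L N f ℤ.- rise L M f
  rise-trans L M N f = telescope (height L f) (height M f) (height N f)
    where
    telescope : ∀ a b c → c ℤ.- b ≡ (c ℤ.- a) ℤ.- (b ℤ.- a)
    telescope = solve-∀

  spike-zero : ∀ b i → spike b (suc i) zero ≡ 0ℤ
  spike-zero b i = ℤₚ.*-zeroʳ (sign b)

  rise-flip-finite : ∀ b {M i} → IsPM G M → Ready b M (suc i) → ∀ g → rise M (flip M (suc i)) g ≡ spike b (suc i) g
  rise-flip-finite b {M} {i} pmM ready g =
    trans (rise-flip b pmM ready g) (trans (cong (λ s → spike b (suc i) g ℤ.- s) (spike-zero b i)) (ℤₚ.+-identityʳ _))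

  rise-after-flip : ∀ b {M i} → IsPM G M → Ready b M (suc i) → ∀ N →
                    rise (flip M (suc i)) N (suc i) ≡ rise M N (suc i) ℤ.- sign b
  rise-after-flip b {M} {i} pmM ready N =
    trans (rise-trans M (flip M (suc i)) N (suc i))
          (cong (λ s → rise M N (suc i) ℤ.- s)
            (trans (rise-flip-finite b pmM ready (suc i))
                   (trans (cong (λ s → sign b ℤ.* s) (indicator-refl (suc i))) (ℤₚ.*-identityʳ (sign b)))))

  rise-elsewhere : ∀ b {M i} → IsPM G M → Ready b M (suc i) → ∀ N j → j ≢ i →
                   rise (flip M (suc i)) N (suc j) ≡ rise M N (suc j)
  rise-elsewhere b {M} {i} pmM ready N j j≢i =
    trans (rise-trans M (flip M (suc i)) N (suc j))
          (trans (cong (λ s → rise M N (suc j) ℤ.- s)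
            (trans (rise-flip-finite b pmM ready (suc j))
                   (trans (cong (λ s → sign b ℤ.* s) (indicator-≢ (j≢i ∘ Finₚ.suc-injective))) (ℤₚ.*-zeroʳ (sign b)))))
            (ℤₚ.+-identityʳ _))

  -- An invariant of alternating walks, since colour and membership both switch at each step. On a
  -- clockwise cycle the value `false` means proper and `true` improper.
  state : Subset d → Fin d → Bool
  state M x = colour x xor lookup M x

  face-next : ∀ x → face (σ (α x)) ≡ face x
  face-next x = trans (face-σ (α x)) (cong face (α-invol x))

  colour-next : ∀ x → colour (σ (α x)) ≡ not (colour x)
  colour-next x = trans (cong col (vert-σ (α x))) (colour-α x)

  -- The darts `α x` and `σ (α x)` start at one vertex and are distinct because they have different
  -- faces. Both edges lie in the difference, and neither matching can contain both, so each
  -- matching contains exactly one.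
  resonant-alternates : ∀ {M N f} → IsPM G M → IsPM G N → symDiff G M N ≡ boundary G f →
                        ∀ x → face x ≡ f → lookup M (σ (α x)) ≡ not (lookup M x)
  resonant-alternates {M} {N} {f} pmM pmN eq x fx = subst (λ m → lookup M y ≡ not m) (pm-α pmM x)
    (alternate (lookup M (α x)) (lookup M y) (lookup N (α x)) (lookup N y)
               (λ p q → αx≢y (pm-unique pmM p q (sym (vert-σ (α x)))))
               (λ p q → αx≢y (pm-unique pmN p q (sym (vert-σ (α x)))))
               (in-diff (α x) (on-boundary-α (trans (cong face (α-invol x)) fx)))
               (in-diff y (on-boundary (trans (face-next x) fx))))
    where
    y = σ (α x)
    αx≢y : α x ≢ y
    αx≢y p = no-bridge x (trans (sym (face-next x)) (cong face (sym p)))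
    in-diff : ∀ z → lookup (boundary G f) z ≡ true → lookup M z xor lookup N z ≡ true
    in-diff z on = trans (sym (lookup-symDiff M N z)) (trans (cong (λ S → lookup S z) eq) on)
    alternate : ∀ m m′ p p′ → (m ≡ true → m′ ≡ true → ⊥) → (p ≡ true → p′ ≡ true → ⊥) →
                m xor p ≡ true → m′ xor p′ ≡ true → m′ ≡ not m
    alternate true true _ _ no-m _ _ _ = ⊥-elim (no-m refl refl)
    alternate true false _ _ _ _ _ _ = refl
    alternate false true _ _ _ _ _ _ = refl
    alternate false false true true _ no-p _ _ = ⊥-elim (no-p refl refl)

  -- The state is carried along the facial orbit, which exhausts the darts of `f`. Hence every edge
  -- of the resonance graph is a flip in one of the two directions.
  resonant-ready : ∀ {M N f} → IsPM G M → IsPM G N → symDiff G M N ≡ boundary G f → ∃ λ b → Ready b M f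
  resonant-ready {M} {N} {f} pmM pmN eq with face-surj f
  ... | x , fx = state M x , λ y fy → along (Equivalence.to (face-orbit x y) (trans fx (sym fy)))
    where
    iter-state : ∀ k → face (iter (σ ∘ α) k x) ≡ f × state M (iter (σ ∘ α) k x) ≡ state M x
    iter-state zero = fx , refl
    iter-state (suc k) with iter-state k
    ... | fk , sk = trans (face-next _) fk ,
      trans (cong₂ _xor_ (colour-next z) (resonant-alternates pmM pmN eq z fk)) (trans (xor-not-not (colour z) (lookup M z)) sk)
      where z = iter (σ ∘ α) k x
    along : ∀ {y} → (∃ λ k → iter (σ ∘ α) k x ≡ y) → state M y ≡ state M x
    along (k , refl) = proj₂ (iter-state k)

  resonant-flip : ∀ {M N f} → symDiff G M N ≡ boundary G f → N ≡ flip M f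
  resonant-flip {M} {N} eq = trans (sym (symDiff-cancel M N)) (cong (symDiff G M) eq)

  flip-adj : ∀ b {M i} → IsPM G M → Ready b M (suc i) → ResAdj G M (flip M (suc i))
  flip-adj b {M} {i} pmM ready = pmM , flip-pm b pmM ready , i , symDiff-cancel M _

  ready-proper : ∀ {M f} → Ready false M f → ProperFace G col M f
  ready-proper {M} {f} ready x fx x∈ = white , trans (colour-α x) (cong not white)
    where
    white : colour x ≡ true
    white with colour x | lookup M x | ready x fx | ∈⇒lookup x∈
    ... | true | true | _ | _ = refl

  -- `ProperFace` says something only about edges of `M`, so one has to be found on `f`. Two
  -- consecutive darts outside `M` would have different states, because their colours differ; so one
  -- of `x` and `σ (α x)` is in `M` and determines `b`.
  proper-ready : ∀ {M f} → IsPM G M → ∀ {b} → Ready b M f → ProperFace G col M f → b ≡ false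
  proper-ready {M} {f} pmM {b} ready pf with face-surj f
  ... | x , fx with lookup M x in Mx | lookup M (σ (α x)) in My
  ...   | true | _ = trans (sym (ready x fx)) (cong₂ _xor_ (proj₁ (pf x fx (lookup⇒∈ Mx))) Mx)
  ...   | false | true = trans (sym (ready (σ (α x)) fy)) (cong₂ _xor_ (proj₁ (pf (σ (α x)) fy (lookup⇒∈ My))) My)
    where fy = trans (face-next x) fx
  ...   | false | false = contradiction
    (trans (trans (sym (cong (λ m → colour x xor m) Mx)) (ready x fx))
           (sym (trans (sym (cong₂ _xor_ (colour-next x) My)) (ready (σ (α x)) fy))))
    (xor-false (colour x))
    where
    fy = trans (face-next x) fx
    xor-false : ∀ c → c xor false ≢ not c xor false
    xor-false true ()
    xor-false false ()

  -- Distance and order of the resonance graph in terms of heights.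

  distance : Subset d → Subset d → ℕ
  distance M N = sumℕ λ i → ∣ rise M N (suc i) ∣

  distance-refl : ∀ M → distance M M ≡ 0
  distance-refl M = trans (sumℕ-cong λ i → cong ∣_∣ (ℤₚ.+-inverseʳ (height M (suc i)))) (sumℕ-zero n)

  distance≡0 : ∀ {M N} → IsPM G M → IsPM G N → distance M N ≡ 0 → M ≡ N
  distance≡0 {M} {N} pmM pmN eq = height-injective pmM pmN λ
    { zero → trans (height-zero M) (sym (height-zero N))
    ; (suc i) → sym (ℤₚ.i-j≡0⇒i≡j _ _ (ℤₚ.∣i∣≡0⇒i≡0 (sumℕ≡0 (λ i → ∣ rise M N (suc i) ∣) eq i))) }

  -- A resonance edge moves one finite height by one and leaves the other heights alone.
  walk-distance : ∀ {M N k} → Walk (ResAdj G) M N k → distance M N ≤ k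
  walk-distance {M} here = ℕₚ.≤-reflexive (distance-refl M)
  walk-distance {M} {N} (step (pmM , pmM′ , i , eq) w) with resonant-ready pmM pmM′ eq | resonant-flip {M} eq
  ... | b , ready | refl = ℕₚ.≤-trans
    (sumℕ-≤suc (λ j → ∣ rise M N (suc j) ∣) (λ j → ∣ rise (flip M (suc i)) N (suc j) ∣) i
      (subst (λ r → ∣ rise M N (suc i) ∣ ≤ suc ∣ r ∣) (sym (rise-after-flip b pmM ready N)) (∣∣-lipschitz b (rise M N (suc i))))
      λ j j≢i → cong ∣_∣ (sym (rise-elsewhere b pmM ready N j j≢i)))
    (s≤s (walk-distance w))

  abstract
    -- Positivity of the signed rise propagates across blocked darts, so `ready-exists` finds a
    -- ready face among the positive ones. It is finite, because the rise vanishes on the infinite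
    -- face.
    advance : ∀ b {M N} → IsPM G M → IsPM G N → ∀ i → 0ℤ ℤ.< sign b ℤ.* rise M N (suc i) →
              ∃ λ j → 0ℤ ℤ.< sign b ℤ.* rise M N (suc j) × Ready b M (suc j)
    advance b {M} {N} pmM pmN i i>0 = finite
      (ready-exists b pmM {λ f → 0ℤ ℤ.< sign b ℤ.* rise M N f} (λ f → 0ℤ ℤₚ.<? sign b ℤ.* rise M N f)
        (λ x bl u → ℤₚ.<-≤-trans u (blocked-rise b pmM pmN bl)) (suc i , i>0))
      where
      finite : (∃ λ f → 0ℤ ℤ.< sign b ℤ.* rise M N f × Ready b M f) →
               ∃ λ j → 0ℤ ℤ.< sign b ℤ.* rise M N (suc j) × Ready b M (suc j)
      finite (suc j , u , ready) = j , u , ready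
      finite (zero , u , _) = contradiction
        (subst (0ℤ ℤ.<_) (trans (cong (λ s → sign b ℤ.* s) (rise-zero M N)) (ℤₚ.*-zeroʳ (sign b))) u) (ℤₚ.<-irrefl refl)

  distance-flip : ∀ b {M j} → IsPM G M → Ready b M (suc j) → ∀ N → 0ℤ ℤ.< sign b ℤ.* rise M N (suc j) →
                  distance M N ≡ suc (distance (flip M (suc j)) N)
  distance-flip b {M} {j} pmM ready N u = sumℕ-suc (λ j → ∣ rise M N (suc j) ∣) (λ i → ∣ rise (flip M (suc j)) N (suc i) ∣) j
    (trans (∣∣-step b _ u) (cong (λ r → suc ∣ r ∣) (sym (rise-after-flip b pmM ready N))))
    λ i i≢j → cong ∣_∣ (sym (rise-elsewhere b pmM ready N i i≢j))

  geodesic : ∀ k {M N} → IsPM G M → IsPM G N → distance M N ≡ k → Walk (ResAdj G) M N k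
  geodesic zero {M} pmM pmN eq = subst (λ N → Walk (ResAdj G) M N 0) (distance≡0 pmM pmN eq) here
  geodesic (suc k) {M} {N} pmM pmN eq with sumℕ>0 (λ i → ∣ rise M N (suc i) ∣) eq
  ... | i , ≢0 with sign-of (rise M N (suc i)) ≢0
  ...   | b , i>0 with advance b pmM pmN i i>0
  ...     | j , j>0 , ready = step (flip-adj b pmM ready)
    (geodesic k (flip-pm b pmM ready) pmN (ℕₚ.suc-injective (trans (sym (distance-flip b pmM ready N j>0)) eq)))

  distance-Dist : ∀ {M N} → IsPM G M → IsPM G N → Dist (ResAdj G) M N (distance M N)
  distance-Dist pmM pmN = geodesic _ pmM pmN refl , λ _ → walk-distance

  star-descends : ∀ {M N} → Star (DirAdj G col) M N → ∀ f → rise M N f ℤ.≤ 0ℤ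
  star-descends {M} ε f = ℤₚ.≤-reflexive (ℤₚ.+-inverseʳ (height M f))
  star-descends {M} {N} ((pmM , pmM′ , i , eq , pf) ◅ path) f
    with resonant-ready pmM pmM′ eq | resonant-flip {M} eq
  ... | b , ready | refl with proper-ready pmM ready pf
  ...   | refl = ℤₚ.≤-trans (ℤₚ.≤-reflexive (split (height M f) (height (flip M (suc i)) f) (height N f)))
      (ℤₚ.+-mono-≤ (ℤₚ.≤-trans (ℤₚ.≤-reflexive (rise-flip-finite false pmM ready f)) (down f)) (star-descends path f))
    where
    split : ∀ a b c → c ℤ.- a ≡ (b ℤ.- a) ℤ.+ (c ℤ.- b)
    split = solve-∀
    down : ∀ g → spike false (suc i) g ℤ.≤ 0ℤ
    down g with ⌊ g ≟ suc i ⌋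
    ... | true = -≤+
    ... | false = ℤₚ.≤-refl

  -- Only faces that are strictly too high are lowered, so a unit step never overshoots and the
  -- hypothesis on the rises survives.
  descend : ∀ k {M N} → IsPM G M → IsPM G N → distance M N ≡ k → (∀ i → rise M N (suc i) ℤ.≤ 0ℤ) →
            Star (DirAdj G col) M N
  descend zero {M} pmM pmN eq below = subst (Star (DirAdj G col) M) (distance≡0 pmM pmN eq) ε
  descend (suc k) {M} {N} pmM pmN eq below with sumℕ>0 (λ i → ∣ rise M N (suc i) ∣) eq
  ... | i , ≢0 with advance false pmM pmN i (negative (rise M N (suc i)) (below i) ≢0)
    where
    negative : ∀ r → r ℤ.≤ 0ℤ → ∣ r ∣ ≢ 0 → 0ℤ ℤ.< sign false ℤ.* r
    negative (+ zero) _ ≢0 = contradiction refl ≢0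
    negative (+ suc r) (+≤+ ()) _
    negative -[1+ r ] _ _ = +<+ (s≤s z≤n)
  ...   | j , j>0 , ready = (pmM , pmM′ , j , symDiff-cancel M _ , ready-proper ready) ◅
      descend k pmM′ pmN (ℕₚ.suc-injective (trans (sym (distance-flip false pmM ready N j>0)) eq)) below′
    where
    M′ = flip M (suc j)
    pmM′ = flip-pm false pmM ready
    succ≤0 : ∀ r → 0ℤ ℤ.< sign false ℤ.* r → r ℤ.- sign false ℤ.≤ 0ℤ
    succ≤0 (+ zero) (+<+ ())
    succ≤0 (+ suc r) ()
    succ≤0 -[1+ zero ] _ = ℤₚ.≤-refl
    succ≤0 -[1+ suc r ] _ = -≤+
    below′ : ∀ i → rise M′ N (suc i) ℤ.≤ 0ℤ
    below′ i with i ≟ j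
    ... | yes refl = subst (ℤ._≤ 0ℤ) (sym (rise-after-flip false pmM ready N)) (succ≤0 _ j>0)
    ... | no i≢j = subst (ℤ._≤ 0ℤ) (sym (rise-elsewhere false pmM ready N i i≢j)) (below i)

  -- Cycles in the difference of two perfect matchings.

  Differ : Subset d → Subset d → Fin d → Set
  Differ M N x = lookup N x ≡ not (lookup M x)

  differ-sym : ∀ {M N x} → Differ M N x → Differ N M x
  differ-sym {M} {N} {x} eq = trans (sym (Bₚ.not-involutive (lookup M x))) (cong not (sym eq))

  differ-α : ∀ {M N} → IsPM G M → IsPM G N → ∀ {x} → Differ M N x → Differ M N (α x)
  differ-α pmM pmN {x} eq = trans (pm-α pmN x) (trans eq (cong not (sym (pm-α pmM x))))

  symDiff⇒differ : ∀ M N {x} → lookup (symDiff G M N) x ≡ true → Differ M N x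
  symDiff⇒differ M N {x} eq = go (lookup M x) (lookup N x) (trans (sym (lookup-symDiff M N x)) eq)
    where
    go : ∀ a b → a xor b ≡ true → b ≡ not a
    go true false _ = refl
    go false true _ = refl

  differ⇒symDiff : ∀ M N {x} → Differ M N x → lookup (symDiff G M N) x ≡ true
  differ⇒symDiff M N {x} eq = trans (lookup-symDiff M N x) (trans (cong (λ s → lookup M x xor s) eq) (go (lookup M x)))
    where
    go : ∀ a → a xor not a ≡ true
    go true = refl
    go false = refl

  differ-same : ∀ {M N} → IsPM G M → IsPM G N → ∀ {x y} → Differ M N x → Differ M N y →
                vert x ≡ vert y → lookup M x ≡ lookup M y → x ≡ y
  differ-same {M} {N} pmM pmN {x} {y} dx dy vxy eq with lookup M x in Mx
  ... | true = pm-unique pmM Mx (sym eq) vxy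
  ... | false = pm-unique pmN dx (trans dy (cong not (sym eq))) vxy

  -- At a vertex the difference has at most one dart from each matching.
  differ-two : ∀ {M N} → IsPM G M → IsPM G N → ∀ {x y z} → Differ M N x → Differ M N y → Differ M N z →
               vert x ≡ vert y → vert z ≡ vert y → x ≢ y → z ≡ x ⊎ z ≡ y
  differ-two {M} {N} pmM pmN {x} {y} {z} dx dy dz vxy vzy x≢y with lookup M z Bₚ.≟ lookup M y
  ... | yes eq = inj₂ (differ-same pmM pmN dz dy vzy eq)
  ... | no z≢ = inj₁ (differ-same pmM pmN dz dx (trans vzy (sym vxy))
    (trans (Bₚ.¬-not z≢) (sym (Bₚ.¬-not (x≢y ∘ differ-same pmM pmN dx dy vxy)))))

  change-differ : ∀ M N x → Differ M N x → change M N x ≡ sign (state M x)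
  change-differ M N x eq =
    trans (cong (λ s → sign (colour x) ℤ.* (bit s ℤ.- bit (lookup M x))) eq) (go (colour x) (lookup M x))
    where
    go : ∀ c m → sign c ℤ.* (bit (not m) ℤ.- bit m) ≡ sign (c xor m)
    go true true = refl
    go true false = refl
    go false true = refl
    go false false = refl

  change-same : ∀ M N x → lookup N x ≡ lookup M x → change M N x ≡ 0ℤ
  change-same M N x eq =
    trans (cong (λ s → sign (colour x) ℤ.* (bit s ℤ.- bit (lookup M x))) eq)
          (trans (cong (λ s → sign (colour x) ℤ.* s) (ℤₚ.+-inverseʳ (bit (lookup M x)))) (ℤₚ.*-zeroʳ (sign (colour x))))

  state-α : ∀ {M} → IsPM G M → ∀ x → state M (α x) ≡ not (state M x)
  state-α {M} pmM x = trans (cong₂ _xor_ (colour-α x) (pm-α pmM x)) (go (colour x) (lookup M x))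
    where
    go : ∀ c m → not c xor m ≡ not (c xor m)
    go true _ = sym (Bₚ.not-involutive _)
    go false _ = refl

  -- Saturation makes `E` a union of components of the difference. At each vertex the result
  -- therefore follows `P` or `Q` consistently; which one is decided by whether the `P`-dart there
  -- lies in `E`.
  exchange-pm : ∀ {P Q} → IsPM G P → IsPM G Q → ∀ E → (∀ x → lookup E (α x) ≡ lookup E x) →
                (∀ {x} → lookup E x ≡ true → Differ P Q x) →
                (∀ {x y} → lookup E x ≡ true → Differ P Q y → vert y ≡ vert x → lookup E y ≡ true) →
                IsPM G (symDiff G P E)
  exchange-pm {P} {Q} pmP pmQ E E-α E⇒differ saturated =
    (λ x x∈ → lookup⇒∈ (trans (S-α x) (∈⇒lookup x∈))) , (λ _ _ → tt) , λ u _ → cover u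
    where
    S = symDiff G P E
    S-α : ∀ x → lookup S (α x) ≡ lookup S x
    S-α x = trans (lookup-symDiff P E (α x)) (trans (cong₂ _xor_ (pm-α pmP x) (E-α x)) (sym (lookup-symDiff P E x)))
    member : ∀ {x p e} → lookup P x ≡ p → lookup E x ≡ e → lookup S x ≡ p xor e
    member p e = trans (lookup-symDiff P E _) (cong₂ _xor_ p e)
    cover : ∀ u → ∃ λ x → x Sub.∈ S × vert x ≡ u × (∀ y → y Sub.∈ S → vert y ≡ u → y ≡ x)
    cover u with mate pmP u | mate pmQ u
    ... | x , Px , vx , uniqueP | y , Qy , vy , uniqueQ with lookup E x in Ex
    ...   | false = x , lookup⇒∈ (member Px Ex) , vx , unique
      where
      unique : ∀ z → z Sub.∈ S → vert z ≡ u → z ≡ x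
      unique z z∈ vz with lookup P z in Pz | lookup E z in Ez
      ... | true | _ = uniqueP z Pz vz
      ... | false | false = contradiction (trans (sym (member Pz Ez)) (∈⇒lookup z∈)) λ ()
      -- Here `z` is the `Q`-dart at `u`. If `x` is one too, they coincide; otherwise `x` lies in
      -- the difference and saturation would put it into `E`.
      ... | false | true with lookup Q x in Qx
      ...   | false = contradiction (trans (sym (saturated Ez (trans Qx (cong not (sym Px))) (trans vx (sym vz)))) Ex) λ ()
      ...   | true = pm-unique pmQ (trans (E⇒differ Ez) (cong not Pz)) Qx (trans vz (sym vx))
    ...   | true = y , lookup⇒∈ (member Py (saturated Ex (trans Qy (cong not (sym Py))) (trans vy (sym vx)))) , vy , unique
      where
      Qx : lookup Q x ≡ false
      Qx = trans (E⇒differ Ex) (cong not Px)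
      Py : lookup P y ≡ false
      Py with lookup P y in Py
      ... | false = refl
      ... | true = contradiction (trans (sym Qy) (trans (cong (lookup Q) (uniqueP y Py vy)) Qx)) λ ()
      unique : ∀ z → z Sub.∈ S → vert z ≡ u → z ≡ y
      unique z z∈ vz with lookup P z in Pz | lookup E z in Ez
      ... | false | true = uniqueQ z (trans (E⇒differ Ez) (cong not Pz)) vz
      ... | false | false = contradiction (trans (sym (member Pz Ez)) (∈⇒lookup z∈)) λ ()
      ... | true | true = contradiction (trans (sym (member Pz Ez)) (∈⇒lookup z∈)) λ ()
      ... | true | false = contradiction
        (trans (sym Ez) (trans (cong (lookup E) (uniqueP z Pz vz)) Ex)) λ ()

  on-cycle? : ∀ (C : Cycle G) y → Dec (OnCycle G C y)
  on-cycle? C y = Finₚ.any? λ i → (y ≟ dart C i) ⊎-dec (α y ≟ dart C i)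

  successor : ∀ (C : Cycle G) i → ∃ λ j → vert (α (dart C i)) ≡ vert (dart C j)
  successor C i with view i
  ... | ‵fromℕ = zero , wrap C
  ... | ‵inject₁ j = suc j , closed C j

  predecessor : ∀ (C : Cycle G) i → ∃ λ j → vert (α (dart C j)) ≡ vert (dart C i)
  predecessor C zero = fromℕ _ , wrap C
  predecessor C (suc i) = inject₁ i , closed C i

  -- From any starting index, run to the last dart, wrap around to dart `zero`, and from there reach
  -- every index.
  cycle-induction : ∀ (C : Cycle G) (P : Fin d → Set) →
                    (∀ i j → vert (α (dart C i)) ≡ vert (dart C j) → P (dart C i) → P (dart C j)) →
                    ∀ {i} → P (dart C i) → ∀ j → P (dart C j)
  cycle-induction C P P-step {i} pi = <-weakInduction (P ∘ dart C)
    (P-step _ _ (wrap C) (<-weakInduction-startingFrom (P ∘ dart C) pi along (Finₚ.≤fromℕ i))) along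
    where
    along = λ j → P-step (inject₁ j) (suc j) (closed C j)

  module InDifference {M} (pmM : IsPM G M) {E} (cyc : CycleOf G (symDiff G M M₀) E) where
    C : Cycle G
    C = proj₁ cyc

    E⇒differ : ∀ {x} → lookup E x ≡ true → Differ M₀ M x
    E⇒differ Ex = differ-sym {M} {M₀} (symDiff⇒differ M M₀ (∈⇒lookup (proj₂ (proj₂ cyc) _ (lookup⇒∈ Ex))))

    E⇒on : ∀ {x} → lookup E x ≡ true → OnCycle G C x
    E⇒on Ex = Equivalence.to (proj₁ (proj₂ cyc) _) (lookup⇒∈ Ex)

    on⇒E : ∀ {x} → OnCycle G C x → lookup E x ≡ true
    on⇒E on = ∈⇒lookup (Equivalence.from (proj₁ (proj₂ cyc) _) on)

    dart∈E : ∀ i → lookup E (dart C i) ≡ true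
    dart∈E i = on⇒E (i , inj₁ refl)

    α-dart∈E : ∀ i → lookup E (α (dart C i)) ≡ true
    α-dart∈E i = on⇒E (i , inj₂ (α-invol (dart C i)))

    E-α : ∀ x → lookup E (α x) ≡ lookup E x
    E-α x with lookup E x in Ex | lookup E (α x) in Eαx
    ... | true | true = refl
    ... | false | false = refl
    ... | true | false = contradiction (trans (sym Eαx) (forth (E⇒on Ex))) λ ()
      where
      forth : OnCycle G C x → lookup E (α x) ≡ true
      forth (i , inj₁ refl) = α-dart∈E i
      forth (i , inj₂ eq) = on⇒E (i , inj₁ eq)
    ... | false | true = contradiction (trans (sym Ex) (back (E⇒on Eαx))) λ ()
      where
      back : OnCycle G C (α x) → lookup E x ≡ true
      back (i , inj₁ eq) = on⇒E (i , inj₂ eq)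
      back (i , inj₂ eq) = on⇒E (i , inj₁ (trans (sym (α-invol x)) eq))

    -- At a vertex of the cycle the incoming dart, reversed, and the outgoing dart already are the
    -- two darts of the difference that `differ-two` allows.
    saturated : ∀ {x y} → lookup E x ≡ true → Differ M₀ M y → vert y ≡ vert x → lookup E y ≡ true
    saturated {x} {y} Ex dy vyx with E⇒on Ex
    ... | i , inj₁ refl with predecessor C i
    ...   | j , v with differ-two pm₀ pmM (E⇒differ (α-dart∈E j)) (E⇒differ (dart∈E i)) dy v vyx (edist C i j ∘ sym)
    ...     | inj₁ refl = α-dart∈E j
    ...     | inj₂ refl = dart∈E i
    saturated {x} {y} Ex dy vyx | i , inj₂ αx≡ with successor C i
    ...   | j , v with differ-two pm₀ pmM (E⇒differ (α-dart∈E i)) (E⇒differ (dart∈E j)) dy v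
                         (trans vyx (trans (cong vert (trans (sym (α-invol x)) (cong α αx≡))) v)) (edist C j i ∘ sym)
    ...     | inj₁ refl = α-dart∈E i
    ...     | inj₂ refl = dart∈E j

    M₀⊕E-pm : IsPM G (symDiff G M₀ E)
    M₀⊕E-pm = exchange-pm pm₀ pmM E E-α E⇒differ saturated

    M⊕E-pm : IsPM G (symDiff G M E)
    M⊕E-pm = exchange-pm pmM pm₀ E E-α (λ Ex → differ-sym {M₀} {M} (E⇒differ Ex))
      (λ Ex dy → saturated Ex (differ-sym {M} {M₀} dy))

    alternates : ∀ i j → vert (α (dart C i)) ≡ vert (dart C j) → lookup M₀ (dart C j) ≡ not (lookup M₀ (dart C i))
    alternates i j v = trans (Bₚ.¬-not λ eq → edist C j i
        (differ-same pm₀ pmM (E⇒differ (dart∈E j)) (E⇒differ (α-dart∈E i)) (sym v) eq))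
      (cong not (pm-α pm₀ (dart C i)))

    state-along : ∀ i j → vert (α (dart C i)) ≡ vert (dart C j) → state M₀ (dart C j) ≡ state M₀ (dart C i)
    state-along i j v = trans (cong₂ _xor_ (trans (cong col (sym v)) (colour-α (dart C i))) (alternates i j v))
      (xor-not-not (colour (dart C i)) (lookup M₀ (dart C i)))

    β : Bool
    β = state M₀ (dart C zero)

    state≡β : ∀ i → state M₀ (dart C i) ≡ β
    state≡β = cycle-induction C (λ x → state M₀ x ≡ β) (λ i j v eq → trans (state-along i j v) eq) {zero} refl

    change-on : ∀ i → change M₀ (symDiff G M₀ E) (dart C i) ≡ sign β
    change-on i = trans (change-differ M₀ (symDiff G M₀ E) (dart C i)
      (trans (lookup-symDiff M₀ E _) (trans (cong (λ s → lookup M₀ (dart C i) xor s) (dart∈E i)) (Bₚ.xor-comm _ true))))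
      (cong sign (state≡β i))

    change-off : ∀ {x} → lookup E x ≡ false → change M₀ (symDiff G M₀ E) x ≡ 0ℤ
    change-off {x} Ex = change-same M₀ (symDiff G M₀ E) x
      (trans (lookup-symDiff M₀ E x) (trans (cong (λ s → lookup M₀ x xor s) Ex) (Bₚ.xor-identityʳ (lookup M₀ x))))

    -- The grown tree lists exactly the faces satisfying `ReachAvoid`, which makes `Interior`
    -- decidable and gives it an indicator function.
    module Sides = Growth face α α-invol α-nofix (λ x → lookup E x ≡ false) zero

    abstract
      outside : ∃₂ λ ps ns → Sides.Tree ps ns × Sides.Closed ns
      outside = Sides.spanning λ x → lookup E x Bₚ.≟ false

    exterior : List (Fin (suc n))
    exterior = proj₁ (proj₂ outside)

    reach⇒exterior : ∀ {f} → ReachAvoid G (Sub._∈ E) f → f ∈ exterior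
    reach⇒exterior outer = Sides.root∈ (proj₁ (proj₂ (proj₂ outside)))
    reach⇒exterior (cross x x∉ r) = proj₂ (proj₂ (proj₂ outside)) x (Bₚ.¬-not (x∉ ∘ lookup⇒∈)) (reach⇒exterior r)

    exterior⇒reach : ∀ {f} → f ∈ exterior → ReachAvoid G (Sub._∈ E) f
    exterior⇒reach = go (proj₁ (proj₂ (proj₂ outside)))
      where
      go : ∀ {ps ns} → Sides.Tree ps ns → ∀ {f} → f ∈ ns → ReachAvoid G (Sub._∈ E) f
      go Sides.root (here refl) = outer
      go (Sides.grow T x Ex x∈ _) (here refl) = cross x (λ x∈E → contradiction (trans (sym Ex) (∈⇒lookup x∈E)) λ ()) (go T x∈)
      go (Sides.grow T _ _ _ _) (there f∈) = go T f∈

    interior : Fin (suc n) → Bool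
    interior f = not ⌊ _∈?_ _≟_ f exterior ⌋

    interior-Interior : ∀ f → interior f ≡ true ⇔ Interior G (Sub._∈ E) f
    interior-Interior f with _∈?_ _≟_ f exterior
    ... | yes f∈ = mk⇔ (λ ()) (λ int → contradiction (exterior⇒reach f∈) int)
    ... | no f∉ = mk⇔ (λ _ r → f∉ (reach⇒exterior r)) (λ _ → refl)

    interior-exterior : ∀ {f} → f ∈ exterior → interior f ≡ false
    interior-exterior {f} f∈ with _∈?_ _≟_ f exterior
    ... | yes _ = refl
    ... | no f∉ = contradiction f∈ f∉

    crossing : ∀ {x} → lookup E x ≡ false → interior (face x) ≡ interior (face (α x))
    crossing {x} Ex with _∈?_ _≟_ (face x) exterior | _∈?_ _≟_ (face (α x)) exterior
    ... | yes _ | yes _ = refl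
    ... | no _ | no _ = refl
    ... | yes p | no ¬q = contradiction (proj₂ (proj₂ (proj₂ outside)) x Ex p) ¬q
    ... | no ¬p | yes q = contradiction
      (subst (λ y → face y ∈ exterior) (α-invol x) (proj₂ (proj₂ (proj₂ outside)) (α x) (trans (E-α x) Ex) q)) ¬p

    χ : Fin (suc n) → ℤ
    χ = bit ∘ interior

    grad-χ-off : ∀ {x} → lookup E x ≡ false → grad χ x ≡ 0ℤ
    grad-χ-off {x} Ex = trans (cong (λ b → χ (face x) ℤ.- bit b) (sym (crossing Ex))) (ℤₚ.+-inverseʳ (χ (face x)))

    -- Conservation at the vertex between two consecutive darts, whose only cycle darts are these two.
    grad-χ-along : ∀ i j → vert (α (dart C i)) ≡ vert (dart C j) → grad χ (dart C j) ≡ grad χ (dart C i)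
    grad-χ-along i j v = ℤₚ.i-j≡0⇒i≡j _ _ (trans (cong (λ s → grad χ y ℤ.+ s) (sym (grad-antisymmetric χ (dart C i))))
      (trans (ℤₚ.+-comm (grad χ y) _) (trans (sym pair) (grad-flow χ u))))
      where
      x = α (dart C i)
      y = dart C j
      u = vert y
      others : ∀ z → z ≢ x → z ≢ y → at u (grad χ) z ≡ 0ℤ
      others z z≢x z≢y = at-zero u (grad χ) z λ vz → grad-χ-off (Bₚ.¬-not λ Ez → neither
        (differ-two pm₀ pmM (E⇒differ (α-dart∈E i)) (E⇒differ (dart∈E j)) (E⇒differ Ez) v vz (edist C j i ∘ sym)) z≢x z≢y)
        where
        neither : ∀ {z} → z ≡ x ⊎ z ≡ y → z ≢ x → z ≢ y → ⊥
        neither (inj₁ p) q _ = q p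
        neither (inj₂ p) _ q = q p
      pair : sum (at u (grad χ)) ≡ grad χ x ℤ.+ grad χ y
      pair = trans (sum-pair (at u (grad χ)) x y (edist C j i ∘ sym) others)
                   (cong₂ ℤ._+_ (at-on u (grad χ) x v) (at-on u (grad χ) y refl))

    κ : ℤ
    κ = grad χ (dart C zero)

    grad-χ-on : ∀ i → grad χ (dart C i) ≡ κ
    grad-χ-on = cycle-induction C (λ x → grad χ x ≡ κ) (λ i j v eq → trans (grad-χ-along i j v) eq) {zero} refl

    heightE : Fin (suc n) → ℤ
    heightE = height (symDiff G M₀ E)

    grad-heightE-on : ∀ i → grad heightE (dart C i) ≡ sign β
    grad-heightE-on i = trans (grad-height M₀⊕E-pm (dart C i)) (change-on i)

    grad-heightE-off : ∀ {x} → lookup E x ≡ false → grad heightE x ≡ 0ℤ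
    grad-heightE-off {x} Ex = trans (grad-height M₀⊕E-pm x) (change-off Ex)

    -- Darts of `E` that run against the listing of `C` are settled by antisymmetry.
    grad-determined : ∀ z z′ → (∀ {x} → lookup E x ≡ false → grad z x ≡ grad z′ x) →
                      (∀ i → grad z (dart C i) ≡ grad z′ (dart C i)) → ∀ x → grad z x ≡ grad z′ x
    grad-determined z z′ off on x with lookup E x in Ex
    ... | false = off Ex
    ... | true with E⇒on Ex
    ...   | i , inj₁ refl = on i
    ...   | i , inj₂ αx≡ = ℤₚ.neg-injective (trans (sym (grad-antisymmetric z x))
      (trans (subst (λ y → grad z y ≡ grad z′ y) (sym αx≡) (on i)) (grad-antisymmetric z′ x)))

    interior-zero : interior zero ≡ false
    interior-zero = interior-exterior (Sides.root∈ (proj₁ (proj₂ (proj₂ outside))))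

    heightE-zero : heightE zero ≡ 0ℤ
    heightE-zero = height-zero (symDiff G M₀ E)

    reach-heightE : ∀ {f} → ReachAvoid G (Sub._∈ E) f → heightE f ≡ 0ℤ
    reach-heightE outer = heightE-zero
    reach-heightE (cross x x∉ r) =
      trans (sym (ℤₚ.i-j≡0⇒i≡j _ _ (grad-heightE-off (Bₚ.¬-not (x∉ ∘ lookup⇒∈))))) (reach-heightE r)

    κ≡signβ⇒heightE≡χ : κ ≡ sign β → ∀ f → heightE f ≡ χ f
    κ≡signβ⇒heightE≡χ eq = grad-injective heightE χ
      (grad-determined heightE χ (λ Ex → trans (grad-heightE-off Ex) (sym (grad-χ-off Ex)))
        (λ i → trans (grad-heightE-on i) (sym (trans (grad-χ-on i) eq))))
      (trans heightE-zero (cong bit (sym interior-zero)))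

    -- The cycle has an inside: otherwise every face is reached from the infinite one, and the height of
    -- M₀ ⊕ E is zero.
    κ≢0 : κ ≢ 0ℤ
    κ≢0 κ≡0 = sign≢0 β (trans (sym (grad-heightE-on zero)) (cong₂ ℤ._-_ (flat _) (flat _)))
      where
      sign≢0 : ∀ b → sign b ≢ 0ℤ
      sign≢0 true ()
      sign≢0 false ()
      χ≡0 : ∀ f → χ f ≡ 0ℤ
      χ≡0 = grad≡0⇒≡0 χ (grad-determined χ (λ _ → 0ℤ) (λ Ex → grad-χ-off Ex) (λ i → trans (grad-χ-on i) κ≡0))
        (cong bit interior-zero)
      flat : ∀ f → heightE f ≡ 0ℤ
      flat f with _∈?_ _≟_ f exterior in eq
      ... | yes f∈ = reach-heightE (exterior⇒reach f∈)
      ... | no _ = contradiction (trans (sym (cong (λ D → bit (not ⌊ D ⌋)) eq)) (χ≡0 f)) λ ()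

    κ≡1⇒inside : κ ≡ 1ℤ → ∀ i → interior (face (dart C i)) ≡ true
    κ≡1⇒inside eq i = go (interior (face (dart C i))) (interior (face (α (dart C i)))) (trans (grad-χ-on i) eq)
      where
      go : ∀ a b → bit a ℤ.- bit b ≡ 1ℤ → a ≡ true
      go true _ _ = refl
      go false true ()
      go false false ()

    κ-values : κ ≢ -1ℤ → κ ≡ 1ℤ
    κ-values = go (interior (face (dart C zero))) (interior (face (α (dart C zero)))) κ≢0
      where
      go : ∀ a b → bit a ℤ.- bit b ≢ 0ℤ → bit a ℤ.- bit b ≢ -1ℤ → bit a ℤ.- bit b ≡ 1ℤ
      go true true ≢0 _ = contradiction refl ≢0
      go true false _ _ = refl
      go false true _ ≢-1 = contradiction refl ≢-1
      go false false ≢0 _ = contradiction refl ≢0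

    reach-subset : ∀ {P Q : Fin d → Set} → (∀ {x} → Q x → P x) → ∀ {f} → ReachAvoid G P f → ReachAvoid G Q f
    reach-subset Q⇒P outer = outer
    reach-subset Q⇒P (cross x ¬p r) = cross x (¬p ∘ Q⇒P) (reach-subset Q⇒P r)

    -- The jump `κ` of the interior indicator is 1 when the inside is on the right, that is, when
    -- `C` is listed clockwise; state `false` then says that its `M₀`-edges go from white to black.
    clockwise-proper : β ≡ false → κ ≡ 1ℤ → ProperAlt G col M₀ C
    clockwise-proper β≡ κ≡ = ((λ i → alternate (inject₁ i) (suc i) (closed C i)) , alternate (fromℕ _) zero (wrap C))
      , (λ i r → Equivalence.to (interior-Interior (face (dart C i))) (κ≡1⇒inside κ≡ i)
                   (reach-subset (λ x∈ → E⇒on (∈⇒lookup x∈)) r))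
      , λ i i∈ → let w = white (colour (dart C i)) (lookup M₀ (dart C i)) (trans (state≡β i) β≡) (∈⇒lookup i∈)
                 in w , trans (colour-α (dart C i)) (cong not w)
      where
      alternate : ∀ i j → vert (α (dart C i)) ≡ vert (dart C j) → lookup M₀ (dart C i) ≢ lookup M₀ (dart C j)
      alternate i j v eq = Bₚ.not-¬ refl (trans eq (alternates i j v))
      white : ∀ c m → c xor m ≡ false → m ≡ true → c ≡ true
      white true true _ _ = refl

    -- The changes from `M₀` to `M₀ ⊕ E` and to `M ⊕ E` have disjoint supports: the first is carried
    -- by `E`, and on `E` the matching `M ⊕ E` agrees with `M₀`. Together they give the change to
    -- `M`.
    height-removed : ∀ f → height M f ≡ heightE f ℤ.+ height (symDiff G M E) f
    height-removed = grad-injective (height M) (λ f → heightE f ℤ.+ height (symDiff G M E) f)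
      (λ x → trans (grad-height pmM x) (trans (sym (split x)) (trans
        (sym (cong₂ ℤ._+_ (grad-height M₀⊕E-pm x) (grad-height M⊕E-pm x)))
        (interchange (heightE (face x)) (heightE (face (α x))) (height (symDiff G M E) (face x)) (height (symDiff G M E) (face (α x)))))))
      (trans (height-zero M) (sym (cong₂ ℤ._+_ heightE-zero (height-zero (symDiff G M E)))))
      where
      interchange : ∀ a b c e → (a ℤ.- b) ℤ.+ (c ℤ.- e) ≡ (a ℤ.+ c) ℤ.- (b ℤ.+ e)
      interchange = solve-∀
      split : ∀ x → change M₀ (symDiff G M₀ E) x ℤ.+ change M₀ (symDiff G M E) x ≡ change M₀ M x
      split x with lookup E x in Ex
      ... | false = trans (cong₂ ℤ._+_ (change-off Ex) refl) (trans (ℤₚ.+-identityˡ _)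
        (cong (λ m → sign (colour x) ℤ.* (bit m ℤ.- bit (lookup M₀ x)))
          (trans (lookup-symDiff M E x) (trans (cong (λ s → lookup M x xor s) Ex) (Bₚ.xor-identityʳ (lookup M x))))))
      ... | true = trans (cong₂ ℤ._+_
          (cong (λ m → sign (colour x) ℤ.* (bit m ℤ.- bit (lookup M₀ x)))
            (trans (lookup-symDiff M₀ E x) (trans (cong (λ s → lookup M₀ x xor s) Ex) (trans (Bₚ.xor-comm _ true) (sym (E⇒differ Ex))))))
          (change-same M₀ (symDiff G M E) x
            (trans (lookup-symDiff M E x) (trans (cong (λ s → lookup M x xor s) Ex) (trans (Bₚ.xor-comm _ true)
              (trans (cong not (E⇒differ Ex)) (Bₚ.not-involutive _)))))))
        (ℤₚ.+-identityʳ _)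

    member⊕ : ∀ x → lookup (symDiff G (symDiff G M E) M₀) x ≡ true → lookup E x ≡ false × lookup (symDiff G M M₀) x ≡ true
    member⊕ x eq with lookup E x in Ex
    ... | true = contradiction
      (trans (sym eq) (trans (lookup-symDiff (symDiff G M E) M₀ x) (cong (λ s → s xor lookup M₀ x)
        (trans (lookup-symDiff M E x) (cong₂ _xor_ (E⇒differ Ex) Ex))))) (cancel (lookup M₀ x))
      where
      cancel : ∀ m → true ≢ (not m xor true) xor m
      cancel true ()
      cancel false ()
    ... | false = refl , trans (lookup-symDiff M M₀ x) (trans (cong (λ s → s xor lookup M₀ x) (sym
        (trans (lookup-symDiff M E x) (trans (cong (λ s → lookup M x xor s) Ex) (Bₚ.xor-identityʳ (lookup M x))))))
        (trans (sym (lookup-symDiff (symDiff G M E) M₀ x)) eq))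

    ⊕member : ∀ x → lookup E x ≡ false → lookup (symDiff G M M₀) x ≡ true → lookup (symDiff G (symDiff G M E) M₀) x ≡ true
    ⊕member x Ex Hx = trans (lookup-symDiff (symDiff G M E) M₀ x) (trans (cong (λ s → s xor lookup M₀ x)
        (trans (lookup-symDiff M E x) (trans (cong (λ s → lookup M x xor s) Ex) (Bₚ.xor-identityʳ (lookup M x)))))
        (trans (sym (lookup-symDiff M M₀ x)) Hx))

    smaller : Sub.∣ symDiff G (symDiff G M E) M₀ ∣ < Sub.∣ symDiff G M M₀ ∣
    smaller = Subₚ.p⊂q⇒∣p∣<∣q∣ {p = symDiff G (symDiff G M E) M₀} {q = symDiff G M M₀}
      ( (λ {x} x∈ → lookup⇒∈ (proj₂ (member⊕ x (∈⇒lookup x∈))))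
      , dart C zero , proj₂ (proj₂ cyc) _ (lookup⇒∈ (dart∈E zero))
      , λ x∈ → contradiction (trans (sym (dart∈E zero)) (proj₁ (member⊕ _ (∈⇒lookup x∈)))) λ ())

  subset-extensionality : ∀ {E F : Subset d} → (∀ x → lookup E x ≡ true → lookup F x ≡ true) →
                          (∀ x → lookup F x ≡ true → lookup E x ≡ true) → E ≡ F
  subset-extensionality {E} {F} E⊆F F⊆E = lookup-ext pointwise
    where
    pointwise : ∀ x → lookup E x ≡ lookup F x
    pointwise x with lookup E x in Ex | lookup F x in Fx
    ... | true | true = refl
    ... | false | false = refl
    ... | true | false = trans (sym (E⊆F x Ex)) Fx
    ... | false | true = trans (sym Ex) (F⊆E x Fx)

  -- Saturation of `F` forces the successor of a shared dart into `F` as well, and this propagates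
  -- around the whole cycle of `E`.
  overlap⇒⊆ : ∀ {M} → IsPM G M → ∀ {E F} → CycleOf G (symDiff G M M₀) E → CycleOf G (symDiff G M M₀) F →
              ∀ {x} → lookup E x ≡ true → lookup F x ≡ true → ∀ y → lookup E y ≡ true → lookup F y ≡ true
  overlap⇒⊆ pmM {E} {F} cycE cycF Ex Fx y Ey = on⇒F (𝓔.E⇒on Ey)
    where
    module 𝓔 = InDifference pmM cycE
    module 𝓕 = InDifference pmM cycF
    shared : ∀ {x} → OnCycle G 𝓔.C x → lookup F x ≡ true → ∃ λ i → lookup F (dart 𝓔.C i) ≡ true
    shared (i , inj₁ refl) Fx = i , Fx
    shared {x} (i , inj₂ αx≡) Fx = i , trans (cong (lookup F) (sym αx≡)) (trans (𝓕.E-α x) Fx)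
    all : ∀ j → lookup F (dart 𝓔.C j) ≡ true
    all = cycle-induction 𝓔.C (λ z → lookup F z ≡ true)
      (λ i j v Fi → 𝓕.saturated (trans (𝓕.E-α _) Fi) (𝓔.E⇒differ (𝓔.dart∈E j)) (sym v))
      (proj₂ (shared (𝓔.E⇒on Ex) Fx))
    on⇒F : ∀ {y} → OnCycle G 𝓔.C y → lookup F y ≡ true
    on⇒F (i , inj₁ refl) = all i
    on⇒F {y} (i , inj₂ αy≡) = trans (sym (𝓕.E-α y)) (trans (cong (lookup F) αy≡) (all i))

  overlap⇒≡ : ∀ {M} → IsPM G M → ∀ {E F} → CycleOf G (symDiff G M M₀) E → CycleOf G (symDiff G M M₀) F →
              ∀ {x} → lookup E x ≡ true → lookup F x ≡ true → E ≡ F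
  overlap⇒≡ pmM cycE cycF Ex Fx =
    subset-extensionality (overlap⇒⊆ pmM cycE cycF Ex Fx) (overlap⇒⊆ pmM cycF cycE Fx Ex)

  -- Tracing the cycle of the difference through a given dart.

  module Tracing {M} (pmM : IsPM G M) where
    -- The walk switches matchings at each vertex: a dart of `M₀` is followed by one of `M`, and
    -- conversely.
    next : Fin d → Fin d
    next x = if lookup M₀ x then proj₁ (mate pmM (vert (α x))) else proj₁ (mate pm₀ (vert (α x)))

    Next : Fin d → Fin d → Set
    Next x y = Differ M₀ M y × vert y ≡ vert (α x) × y ≢ α x

    next-in-M : ∀ {x y} → Differ M₀ M x → lookup M₀ x ≡ true → lookup M y ≡ true → vert y ≡ vert (α x) → Next x y
    next-in-M {x} {y} dx M₀x My vy = trans My (cong not (sym M₀y)) , vy ,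
      λ y≡ → contradiction (trans (sym M₀y) (trans (cong (lookup M₀) y≡) M₀αx)) λ ()
      where
      M₀αx = trans (pm-α pm₀ x) M₀x
      M₀y : lookup M₀ y ≡ false
      M₀y with lookup M₀ y in M₀y
      ... | false = refl
      ... | true = contradiction (trans (sym My) (trans (cong (lookup M) (pm-unique pm₀ M₀y M₀αx vy))
        (trans (pm-α pmM x) (trans dx (cong not M₀x))))) λ ()

    next-in-M₀ : ∀ {x y} → Differ M₀ M x → lookup M₀ x ≡ false → lookup M₀ y ≡ true → vert y ≡ vert (α x) → Next x y
    next-in-M₀ {x} {y} dx M₀x M₀y vy = trans My (cong not (sym M₀y)) , vy ,
      λ y≡ → contradiction (trans (sym M₀y) (trans (cong (lookup M₀) y≡) M₀αx)) λ ()
      where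
      M₀αx = trans (pm-α pm₀ x) M₀x
      My : lookup M y ≡ false
      My with lookup M y in My
      ... | false = refl
      ... | true = contradiction (trans (sym M₀y) (trans (cong (lookup M₀)
        (pm-unique pmM My (trans (pm-α pmM x) (trans dx (cong not M₀x))) vy)) M₀αx)) λ ()

    next-spec : ∀ {x} → Differ M₀ M x → Next x (next x)
    next-spec {x} dx = choose (lookup M₀ x) refl
      where
      in-M = mate pmM (vert (α x))
      in-M₀ = mate pm₀ (vert (α x))
      choose : ∀ b → lookup M₀ x ≡ b → Next x (if b then proj₁ in-M else proj₁ in-M₀)
      choose true eq = next-in-M dx eq (proj₁ (proj₂ in-M)) (proj₁ (proj₂ (proj₂ in-M)))
      choose false eq = next-in-M₀ dx eq (proj₁ (proj₂ in-M₀)) (proj₁ (proj₂ (proj₂ in-M₀)))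

    -- With a common successor, `α x`, `α y` and `next x` start at one vertex, where the difference
    -- has only two darts. The walk never turns back, so `α y` is not the successor and must equal
    -- `α x`.
    next-injective : ∀ {x y} → Differ M₀ M x → Differ M₀ M y → next x ≡ next y → x ≡ y
    next-injective {x} {y} dx dy eq with next-spec dx | next-spec dy
    ... | dnx , vnx , nx≢ | _ , vny , ny≢ with
      differ-two pm₀ pmM (differ-α pm₀ pmM dx) dnx (differ-α pm₀ pmM dy) (sym vnx) (trans (sym vny) (cong vert (sym eq))) (nx≢ ∘ sym)
    ...   | inj₁ αy≡αx = trans (sym (α-invol x)) (trans (cong α (sym αy≡αx)) (α-invol y))
    ...   | inj₂ αy≡nx = contradiction (trans (sym eq) (sym αy≡nx)) ny≢

    state-next : ∀ {x} → Differ M₀ M x → state M₀ (next x) ≡ state M₀ x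
    state-next {x} dx with next-spec dx
    ... | dnx , vnx , nx≢ = trans (cong₂ _xor_ (trans (cong col vnx) (colour-α x))
          (trans (Bₚ.¬-not (nx≢ ∘ differ-same pm₀ pmM dnx (differ-α pm₀ pmM dx) vnx)) (cong not (pm-α pm₀ x))))
        (xor-not-not (colour x) (lookup M₀ x))

    module From {x₀} (dx₀ : Differ M₀ M x₀) where
      orbit : ℕ → Fin d
      orbit k = iter next k x₀

      orbit-differ : ∀ k → Differ M₀ M (orbit k)
      orbit-differ zero = dx₀
      orbit-differ (suc k) = proj₁ (next-spec (orbit-differ k))

      orbit-state : ∀ k → state M₀ (orbit k) ≡ state M₀ x₀
      orbit-state zero = refl
      orbit-state (suc k) = trans (state-next (orbit-differ k)) (orbit-state k)

      orbit-vert : ∀ k → vert (α (orbit k)) ≡ vert (orbit (suc k))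
      orbit-vert k = sym (proj₁ (proj₂ (next-spec (orbit-differ k))))

      -- Injectivity shifts a coincidence back to the start, so the orbit is purely periodic: a
      -- repetition is always a return to the starting dart.
      cancel : ∀ i k → orbit i ≡ orbit (i ℕ.+ k) → x₀ ≡ orbit k
      cancel zero k eq = eq
      cancel (suc i) k eq = cancel i k (next-injective (orbit-differ i) (orbit-differ (i ℕ.+ k)) eq)

      return : ∀ {i j} → i < j → orbit i ≡ orbit j → ∃ λ k → suc k ≤ j × orbit (suc k) ≡ x₀
      return {i} {j} i<j eq = j ℕ.∸ suc i , subst (_≤ j) diff (ℕₚ.m∸n≤m j i) , sym (cancel i (suc (j ℕ.∸ suc i))
        (trans eq (cong orbit (trans (sym (ℕₚ.m+[n∸m]≡n (ℕₚ.<⇒≤ i<j))) (cong (i ℕ.+_) diff)))))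
        where
        diff : j ℕ.∸ i ≡ suc (j ℕ.∸ suc i)
        diff = ℕₚ.+-∸-assoc 1 i<j

      abstract
        recurrent : ∃ λ k → orbit (suc k) ≡ x₀
        recurrent with Finₚ.pigeonhole (ℕₚ.n<1+n d) (orbit ∘ toℕ)
        ... | i , j , i<j , eq with return i<j eq
        ...   | k , _ , back = k , back

        period : ∃ λ m → orbit (suc m) ≡ x₀ × (∀ j → j < m → orbit (suc j) ≢ x₀)
        period = least (λ k → orbit (suc k) ≟ x₀) (proj₁ recurrent) (proj₂ recurrent)

      ℓ = proj₁ period

      distinct : ∀ i j → i < suc ℓ → j < suc ℓ → orbit i ≡ orbit j → i ≡ j
      distinct i j i≤ j≤ eq with ℕₚ.<-cmp i j
      ... | tri≈ _ i≡j _ = i≡j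
      ... | tri< i<j _ _ with return i<j eq
      ...   | k , k<j , back = contradiction back (proj₂ (proj₂ period) k (ℕₚ.<-≤-trans k<j (ℕₚ.≤-pred j≤)))
      distinct i j i≤ j≤ eq | tri> _ _ j<i with return j<i (sym eq)
      ...   | k , k<i , back = contradiction back (proj₂ (proj₂ period) k (ℕₚ.<-≤-trans k<i (ℕₚ.≤-pred i≤)))

      trace : Cycle G
      trace = record
        -- A cycle with `len` equal to `ℓ` has `suc ℓ` darts, and `suc ℓ` is the period of the
        -- orbit.
        { len = ℓ
        ; dart = orbit ∘ toℕ
        ; closed = λ i → trans (cong (vert ∘ α ∘ orbit) (Finₚ.toℕ-inject₁ i)) (orbit-vert (toℕ i))
        ; wrap = trans (cong (vert ∘ α ∘ orbit) (Finₚ.toℕ-fromℕ ℓ)) (trans (orbit-vert ℓ) (cong vert (proj₁ (proj₂ period))))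
        -- Equal tails have equal colours; with the common state, membership in `M₀` agrees as well,
        -- so the two darts coincide and minimality of the period identifies the indices.
        ; vinj = λ i j v → Finₚ.toℕ-injective (distinct _ _ (Finₚ.toℕ<n i) (Finₚ.toℕ<n j)
            (differ-same pm₀ pmM (orbit-differ (toℕ i)) (orbit-differ (toℕ j)) v
              (xor-cancel (colour (orbit (toℕ i))) _ _ (trans (orbit-state (toℕ i))
                (trans (sym (orbit-state (toℕ j))) (cong (λ u → col u xor lookup M₀ (orbit (toℕ j))) (sym v)))))))
        -- Reversing a dart switches its state, which is constant on the orbit.
        ; edist = λ i j eq → Bₚ.not-¬ refl (trans (orbit-state (toℕ j)) (trans (sym (orbit-state (toℕ i)))
            (trans (cong (state M₀) eq) (state-α pm₀ _))))
        }
        where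
        xor-cancel : ∀ c m m′ → c xor m ≡ c xor m′ → m ≡ m′
        xor-cancel true m m′ eq = Bₚ.not-injective eq
        xor-cancel false m m′ eq = eq

      edges : Subset d
      edges = tabulate λ y → ⌊ on-cycle? trace y ⌋

      edges⇒on : ∀ y → y Sub.∈ edges → OnCycle G trace y
      edges⇒on y y∈ with on-cycle? trace y | trans (sym (lookup∘tabulate (λ y → ⌊ on-cycle? trace y ⌋) y)) (∈⇒lookup y∈)
      ... | yes on | _ = on

      on⇒edges : ∀ y → OnCycle G trace y → y Sub.∈ edges
      on⇒edges y on = lookup⇒∈ (trans (lookup∘tabulate _ y) computed)
        where
        computed : ⌊ on-cycle? trace y ⌋ ≡ true
        computed with on-cycle? trace y
        ... | yes _ = refl
        ... | no ¬on = contradiction on ¬on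

      traced : CycleOf G (symDiff G M M₀) edges
      traced = trace , (λ y → mk⇔ (edges⇒on y) (on⇒edges y)) , λ y y∈ → in-difference (edges⇒on y y∈)
        where
        D⇒∈ : ∀ {y} → Differ M₀ M y → y Sub.∈ symDiff G M M₀
        D⇒∈ dy = lookup⇒∈ (differ⇒symDiff M M₀ (differ-sym {M₀} {M} dy))
        in-difference : ∀ {y} → OnCycle G trace y → y Sub.∈ symDiff G M M₀
        in-difference (i , inj₁ refl) = D⇒∈ (orbit-differ (toℕ i))
        in-difference {y} (i , inj₂ αy≡) = D⇒∈ (subst (Differ M₀ M) (α-invol y)
          (differ-α pm₀ pmM (subst (Differ M₀ M) (sym αy≡) (orbit-differ (toℕ i)))))

  abstract
    cycle-through : ∀ {M} → IsPM G M → ∀ {x} → Differ M₀ M x →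
                    ∃₂ λ E (cyc : CycleOf G (symDiff G M M₀) E) → state M₀ (dart (proj₁ cyc) zero) ≡ state M₀ x
    cycle-through pmM dx = edges , traced , refl
      where open Tracing.From pmM dx

  -- Heights count the cycles around a face.

  module Counting (no-proper : ¬ (∃ λ C → ProperAlt G col M₀ C)) where

    Coded : Subset d → Fin (suc n) → Set
    Coded M f = ∃ λ k → PhiIs G col M₀ M f k × + k ≡ height M f

    coded : ∀ {M} → IsPM G M → Acc _<_ Sub.∣ symDiff G M M₀ ∣ → ∀ f → Coded M f
    coded {M} pmM (acc rec) f with Finₚ.any? (λ x → lookup (symDiff G M M₀) x Bₚ.≟ true)
    ... | no none = 0 , ([] , [] , (λ E → mk⇔ (λ ()) λ { (cyc , _) → ⊥-elim (no-cycle cyc) }) , refl) ,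
        sym (trans (height-unique pmM (λ _ → 0ℤ) refl (λ x → sym (change-same M₀ M x (same x))) f) refl)
      where
      no-cycle : ∀ {E} → CycleOf G (symDiff G M M₀) E → ⊥
      no-cycle (C , on , ⊆H) = none (dart C zero , ∈⇒lookup (⊆H _ (Equivalence.from (on _) (zero , inj₁ refl))))
      same : ∀ x → lookup M x ≡ lookup M₀ x
      same x with lookup M x Bₚ.≟ lookup M₀ x
      ... | yes eq = eq
      ... | no ≢ = contradiction (x , differ⇒symDiff M M₀ (Bₚ.¬-not (≢ ∘ sym))) none
    ... | yes (x , Hx) = result (coded M⊕E-pm (rec smaller) f)
      where
      -- Of the two darts of the edge, the one with state `false` is chosen: the traced cycle then
      -- has its `M₀`-edges running from white to black, so listed clockwise it would be proper.
      start : ∃ λ y → Differ M₀ M y × state M₀ y ≡ false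
      start with state M₀ x in sx
      ... | false = x , dx , sx
        where dx = differ-sym {M} {M₀} (symDiff⇒differ M M₀ Hx)
      ... | true = α x , differ-α pm₀ pmM (differ-sym {M} {M₀} (symDiff⇒differ M M₀ Hx)) , trans (state-α pm₀ x) (cong not sx)
      through = cycle-through pmM (proj₁ (proj₂ start))
      E = proj₁ through
      cycE = proj₁ (proj₂ through)
      open InDifference pmM cycE

      β≡false : β ≡ false
      β≡false = trans (proj₂ (proj₂ through)) (proj₂ (proj₂ start))

      H′ = symDiff G (symDiff G M E) M₀

      heightE≡χ : ∀ f → heightE f ≡ χ f
      heightE≡χ = κ≡signβ⇒heightE≡χ κ≡
        where
        κ≡ : κ ≡ sign β
        -- The remaining value `κ = 1` would make the cycle proper for `M₀`. So the inside is on the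
        -- left, and the jumps of height and indicator have the same sign.
        κ≡ with κ ℤₚ.≟ -1ℤ
        ... | yes eq = trans eq (cong sign (sym β≡false))
        ... | no ≢ = contradiction (C , clockwise-proper β≡false (κ-values ≢)) no-proper

      split-height : height M f ≡ χ f ℤ.+ height (symDiff G M E) f
      split-height = trans (height-removed f) (cong (λ s → s ℤ.+ height (symDiff G M E) f) (heightE≡χ f))

      widen : ∀ {F} → CycleOf G H′ F → CycleOf G (symDiff G M M₀) F
      widen (K , on , ⊆H′) = K , on , λ y y∈ → lookup⇒∈ (proj₂ (member⊕ y (∈⇒lookup (⊆H′ y y∈))))

      -- A cycle that shares a dart with `E` is `E`; any other survives the removal of `E`. So the
      -- lists for `M` and for `M ⊕ E` can differ only by `E` itself.
      component : ∀ {F} → CycleOf G (symDiff G M M₀) F → F ≡ E ⊎ CycleOf G H′ F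
      component {F} cyc@(K , on , ⊆H) with Finₚ.any? (λ x → (lookup F x Bₚ.≟ true) ×-dec (lookup E x Bₚ.≟ true))
      ... | yes (x , Fx , Ex) = inj₁ (overlap⇒≡ pmM cyc cycE Fx Ex)
      ... | no disjoint = inj₂ (K , on , λ y y∈ → lookup⇒∈ (⊕member y
        (Bₚ.¬-not λ Ey → disjoint (y , ∈⇒lookup y∈ , Ey)) (∈⇒lookup (⊆H y y∈))))

      E-not-cycle : ¬ CycleOf G H′ E
      E-not-cycle (_ , _ , ⊆H′) = contradiction
        (trans (sym (dart∈E zero)) (proj₁ (member⊕ _ (∈⇒lookup (⊆H′ _ (lookup⇒∈ (dart∈E zero))))))) λ ()

      result : Coded (symDiff G M E) f → Coded M f
      result (k , (L , unique , member , len≡) , k≡) with interior f in int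
      ... | true = suc k , (E ∷ L , ∉⇒All≢ (E-not-cycle ∘ proj₁ ∘ Equivalence.to (member E)) ∷ unique ,
            (λ F → mk⇔ (to F) (from F)) , cong suc len≡) ,
          sym (trans split-height (cong₂ ℤ._+_ (cong bit int) (sym k≡)))
        where
        to : ∀ F → F ∈ E ∷ L → CycleOf G (symDiff G M M₀) F × Interior G (Sub._∈ F) f
        to F (here refl) = cycE , Equivalence.to (interior-Interior f) int
        to F (there F∈) with Equivalence.to (member F) F∈
        ... | cyc , inside = widen cyc , inside
        from : ∀ F → CycleOf G (symDiff G M M₀) F × Interior G (Sub._∈ F) f → F ∈ E ∷ L
        from F (cyc , inside) with component cyc
        ... | inj₁ refl = here refl
        ... | inj₂ cyc′ = there (Equivalence.from (member F) (cyc′ , inside))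
      ... | false = k , (L , unique , (λ F → mk⇔ (to F) (from F)) , len≡) ,
          sym (trans split-height (trans (cong₂ ℤ._+_ (cong bit int) (sym k≡)) (ℤₚ.+-identityˡ (+ k))))
        where
        to : ∀ F → F ∈ L → CycleOf G (symDiff G M M₀) F × Interior G (Sub._∈ F) f
        to F F∈ with Equivalence.to (member F) F∈
        ... | cyc , inside = widen cyc , inside
        from : ∀ F → CycleOf G (symDiff G M M₀) F × Interior G (Sub._∈ F) f → F ∈ L
        from F (cyc , inside) with component cyc
        ... | inj₁ refl = contradiction (trans (sym int) (Equivalence.from (interior-Interior f) inside)) λ ()
        ... | inj₂ cyc′ = Equivalence.from (member F) (cyc′ , inside)

-- Isometric embeddings and binary heights.

module Coding {d v n : ℕ} (G : PlaneGraph d v n) (col : Fin v → Bool)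
                 (proper : ProperColoring G col) (elementary : Elementary G) (i₀ : Fin n)
                 (M₀ : Subset d) (bottom : IsBottom G col M₀) where
  pm₀ : IsPM G M₀
  pm₀ = proj₁ bottom

  open PlaneGraph G
  open Plane G
  open Matchings G col proper elementary i₀ M₀ pm₀
  open Counting (proj₂ bottom)

  abstract
    encoding : ∀ {M} → IsPM G M → ∀ f → Coded M f
    encoding pmM = coded pmM (<-wellFounded _)

  -- A number of cycles cannot be negative; hence `M₀` lies below every perfect matching.
  height≥0 : ∀ {M} → IsPM G M → ∀ f → 0ℤ ℤ.≤ height M f
  height≥0 pmM f = subst (0ℤ ℤ.≤_) (proj₂ (proj₂ (encoding pmM f))) (+≤+ z≤n)

  height-M₀ : ∀ f → height M₀ f ≡ 0ℤ
  height-M₀ = height-unique pm₀ (λ _ → 0ℤ) refl λ x → sym (change-same M₀ M₀ x refl)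

  rise-M₀ : ∀ M f → rise M₀ M f ≡ height M f
  rise-M₀ M f = trans (cong (λ s → height M f ℤ.- s) (height-M₀ f)) (ℤₚ.+-identityʳ _)

  -- The only face of M₀ that can be lowered is the infinite one, and lowering it raises all the others.
  ready₀ : Ready false M₀ zero
  ready₀ = infinite (ready-exists false pm₀ {λ _ → ⊤} (λ _ → yes tt) (λ _ _ _ → tt) (zero , tt))
    where
    negative : ∀ i → Ready false M₀ (suc i) → height (flip M₀ (suc i)) (suc i) ≡ -1ℤ
    negative i ready = trans (sym (rise-M₀ (flip M₀ (suc i)) (suc i))) (trans (rise-flip-finite false pm₀ ready (suc i))
      (cong (λ s → -1ℤ ℤ.* s) (indicator-refl (suc i))))
    infinite : (∃ λ f → ⊤ × Ready false M₀ f) → Ready false M₀ zero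
    infinite (zero , _ , ready) = ready
    infinite (suc i , _ , ready) = contradiction
      (subst (0ℤ ℤ.≤_) (negative i ready) (height≥0 (flip-pm false pm₀ ready) (suc i))) λ ()

  N₁ : Subset d
  N₁ = flip M₀ zero

  pm₁ : IsPM G N₁
  pm₁ = flip-pm false pm₀ ready₀

  rise-flip₀ : ∀ {M} → IsPM G M → Ready false M zero → ∀ i → rise M (flip M zero) (suc i) ≡ 1ℤ
  rise-flip₀ pmM ready i = rise-flip false pmM ready (suc i)

  height-N₁ : ∀ i → height N₁ (suc i) ≡ 1ℤ
  height-N₁ i = trans (sym (rise-M₀ N₁ (suc i))) (rise-flip₀ pm₀ ready₀ i)

  distance-M₀-N₁ : distance M₀ N₁ ≡ n
  distance-M₀-N₁ = sumℕ-ones _ λ i → cong ∣_∣ (trans (rise-M₀ N₁ (suc i)) (height-N₁ i))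

  isometric-hamming : (c : Subset d → Vec Bool m) → Isometric G c → ∀ {M N} → IsPM G M → IsPM G N →
                      hamming (c M) (c N) ≡ distance M N
  isometric-hamming c iso {M} {N} pmM pmN =
    Dist-unique (hamming-Dist (c M) (c N)) (Equivalence.to (iso M N pmM pmN _) (distance-Dist pmM pmN))

  embeds⇒n≤ : Embeds G m → n ≤ m
  embeds⇒n≤ {m} (c , iso) =
    subst (_≤ m) (trans (isometric-hamming c iso pm₀ pm₁) distance-M₀-N₁) (hamming≤ (c M₀) (c N₁))

  Binary : Set
  Binary = ∀ {M} → IsPM G M → ∀ i → height M (suc i) ≡ 0ℤ ⊎ height M (suc i) ≡ 1ℤ

  -- The images of M₀ and N₁ are antipodal, so every perfect matching lies on a geodesic between them.
  embeds⇒binary : Embeds G n → Binary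
  embeds⇒binary (c , iso) {M} pmM i = detour≡1 (height M (suc i))
    (subst₂ (λ a b → ∣ a ∣ ℕ.+ ∣ b ∣ ≡ 1) (rise-M₀ M (suc i)) (to-N₁ i)
      (sumℕ≤⇒ones (λ i → ∣ rise M₀ M (suc i) ∣ ℕ.+ ∣ rise M N₁ (suc i) ∣)
        (λ i → subst₂ (λ a b → 1 ≤ ∣ a ∣ ℕ.+ ∣ b ∣) (sym (rise-M₀ M (suc i))) (sym (to-N₁ i)) (detour≥1 (height M (suc i))))
        (ℕₚ.≤-reflexive total) i))
    where
    to-N₁ : ∀ i → rise M N₁ (suc i) ≡ 1ℤ ℤ.- height M (suc i)
    to-N₁ i = cong (λ s → s ℤ.- height M (suc i)) (height-N₁ i)
    bits = λ (P : Subset d) i → lookup (c P) i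
    antipodal : ∀ i → disagree (bits M₀ i) (bits N₁ i) ≡ 1
    antipodal = sumℕ≥⇒ones (λ i → disagree (bits M₀ i) (bits N₁ i)) (λ i → disagree≤1 (bits M₀ i) (bits N₁ i))
      (ℕₚ.≤-reflexive (sym (trans (isometric-hamming c iso pm₀ pm₁) distance-M₀-N₁)))
    total : sumℕ (λ i → ∣ rise M₀ M (suc i) ∣ ℕ.+ ∣ rise M N₁ (suc i) ∣) ≡ n
    total = begin
      sumℕ (λ i → ∣ rise M₀ M (suc i) ∣ ℕ.+ ∣ rise M N₁ (suc i) ∣)
        ≡⟨ sumℕ-+ (λ i → ∣ rise M₀ M (suc i) ∣) (λ i → ∣ rise M N₁ (suc i) ∣) ⟩
      distance M₀ M ℕ.+ distance M N₁
        ≡⟨ sym (cong₂ ℕ._+_ (isometric-hamming c iso pm₀ pmM) (isometric-hamming c iso pmM pm₁)) ⟩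
      hamming (c M₀) (c M) ℕ.+ hamming (c M) (c N₁)
        ≡⟨ sym (sumℕ-+ (λ i → disagree (bits M₀ i) (bits M i)) (λ i → disagree (bits M i) (bits N₁ i))) ⟩
      sumℕ (λ i → disagree (bits M₀ i) (bits M i) ℕ.+ disagree (bits M i) (bits N₁ i))
        ≡⟨ sumℕ-ones _ (λ i → disagree-antipodal (bits M₀ i) (bits M i) (bits N₁ i) (antipodal i)) ⟩
      n ∎
      where open ≡-Reasoning

  code : Subset d → Vec Bool n
  code M = tabulate λ i → ⌊ height M (suc i) ℤₚ.≟ 1ℤ ⌋

  module _ (binary : Binary) where
    bit-code : ∀ {M} → IsPM G M → ∀ i → bit (lookup (code M) i) ≡ height M (suc i)
    bit-code {M} pmM i = trans (cong bit (lookup∘tabulate _ i)) (computed (binary pmM i))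
      where
      computed : height M (suc i) ≡ 0ℤ ⊎ height M (suc i) ≡ 1ℤ → bit ⌊ height M (suc i) ℤₚ.≟ 1ℤ ⌋ ≡ height M (suc i)
      computed (inj₁ eq) rewrite eq = refl
      computed (inj₂ eq) rewrite eq = refl

    rise-code : ∀ {M N} → IsPM G M → IsPM G N → ∀ i →
                rise M N (suc i) ≡ bit (lookup (code N) i) ℤ.- bit (lookup (code M) i)
    rise-code pmM pmN i = sym (cong₂ ℤ._-_ (bit-code pmN i) (bit-code pmM i))

    code-hamming : ∀ {M N} → IsPM G M → IsPM G N → hamming (code M) (code N) ≡ distance M N
    code-hamming {M} {N} pmM pmN = sumℕ-cong λ i →
      trans (disagree≡∣bit-bit∣ (lookup (code M) i) (lookup (code N) i)) (cong ∣_∣ (sym (rise-code pmM pmN i)))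

    code-isometric : Isometric G code
    code-isometric M N pmM pmN k = mk⇔
      (λ dist → subst (Dist QAdj (code M) (code N))
        (trans (code-hamming pmM pmN) (Dist-unique (distance-Dist pmM pmN) dist)) (hamming-Dist (code M) (code N)))
      (λ dist → subst (Dist (ResAdj G) M N)
        (trans (sym (code-hamming pmM pmN)) (Dist-unique (hamming-Dist (code M) (code N)) dist)) (distance-Dist pmM pmN))

    code-counts : ∀ M → IsPM G M → ∀ i → PhiIs G col M₀ M (suc i) (if lookup (code M) i then 1 else 0)
    code-counts M pmM i = subst (PhiIs G col M₀ M (suc i)) (ℤₚ.+-injective
      (trans (proj₂ (proj₂ (encoding pmM (suc i)))) (trans (sym (bit-code pmM i)) (bit-+ (lookup (code M) i)))))
      (proj₁ (proj₂ (encoding pmM (suc i))))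
      where
      bit-+ : ∀ b → bit b ≡ + (if b then 1 else 0)
      bit-+ true = refl
      bit-+ false = refl

    code-order : ∀ M M′ → IsPM G M → IsPM G M′ →
                 (_≤L_ G col M′ M) ⇔ (∀ i → lookup (code M′) i B.≤ lookup (code M) i)
    code-order M M′ pmM pmM′ = mk⇔
      (λ path i → Equivalence.to (bit-≤ (lookup (code M′) i) (lookup (code M) i))
        (subst (ℤ._≤ 0ℤ) (rise-code pmM pmM′ i) (star-descends path (suc i))))
      (λ below → descend _ pmM pmM′ refl λ i → subst (ℤ._≤ 0ℤ) (sym (rise-code pmM pmM′ i))
        (Equivalence.from (bit-≤ (lookup (code M′) i) (lookup (code M) i)) (below i)))

    binary⇒embeds : Embeds G n
    binary⇒embeds = code , code-isometric

  -- The periphery and the matchings of the inner vertices.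

  periphery : Subset d
  periphery = boundary G zero

  -- The two periphery edges at a periphery vertex have opposite membership in P.
  periphery-matched : ∀ {b P} → IsPM G P → Ready b P zero → ∀ {y} → face y ≡ zero →
                      ∃ λ w → lookup P w ≡ true × vert w ≡ vert y × lookup periphery w ≡ true
  periphery-matched {b} {P} pmP ready {y} fy with lookup P y in Py
  ... | true = y , Py , refl , on-boundary fy
  ... | false = w , trans (sym (pm-α pmP w)) Pz , vw , on-boundary-α fz
    where
    w = σ⁻¹ y
    vw : vert w ≡ vert y
    vw = trans (sym (vert-σ w)) (cong vert (σσ⁻¹ y))
    fz : face (α w) ≡ zero
    fz = trans (sym (face-σ w)) (trans (cong face (σσ⁻¹ y)) fy)
    go : ∀ c m → not c xor m ≡ c xor false → m ≡ true
    go true true _ = refl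
    go false true _ = refl
    go true false ()
    go false false ()
    Pz : lookup P (α w) ≡ true
    Pz = go (colour y) _ (trans (cong (λ c → c xor lookup P (α w)) (sym (trans (colour-α w) (cong (not ∘ col) vw))))
      (trans (ready (α w) fz) (trans (sym (ready y fy)) (cong (λ m → colour y xor m) Py))))

  periphery-vertex : ∀ {x} → lookup periphery x ≡ true → ¬ OffPeriphery G (vert x)
  periphery-vertex {x} on off with boundary-faces zero x on
  ... | inj₁ fx = off x fx refl
  ... | inj₂ fαx = off (σ x) (trans (face-σ x) fαx) (vert-σ x)

  inner : Subset d → Subset d
  inner P = tabulate λ x → lookup P x ∧ not (lookup periphery x)

  lookup-inner : ∀ P x → lookup (inner P) x ≡ lookup P x ∧ not (lookup periphery x)
  lookup-inner P = lookup∘tabulate _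

  inner-member : ∀ P x → lookup (inner P) x ≡ true → lookup P x ≡ true × lookup periphery x ≡ false
  inner-member P x eq = go (lookup P x) (lookup periphery x) (trans (sym (lookup-inner P x)) eq)
    where
    go : ∀ p q → p ∧ not q ≡ true → p ≡ true × q ≡ false
    go true false _ = refl , refl

  -- When the infinite face is ready, `P` matches every periphery vertex by a periphery edge.
  -- Deleting these edges thus leaves no edge at the periphery and loses none at an inner vertex.
  inner-pm : ∀ {b P} → IsPM G P → Ready b P zero → IsPMOn G (OffPeriphery G) (inner P)
  inner-pm {b} {P} pmP ready = closed-α , off , cover
    where
    closed-α : ∀ x → x Sub.∈ inner P → α x Sub.∈ inner P
    closed-α x x∈ = lookup⇒∈ (trans (lookup-inner P (α x)) (trans
      (cong₂ (λ p q → p ∧ not q) (pm-α pmP x) (boundary-α zero x)) (trans (sym (lookup-inner P x)) (∈⇒lookup x∈))))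
    off : ∀ x → x Sub.∈ inner P → OffPeriphery G (vert x)
    off x x∈ y fy vy with inner-member P x (∈⇒lookup x∈) | periphery-matched pmP ready fy
    ... | Px , ¬on | w , Pw , vw , on = contradiction
      (trans (sym ¬on) (trans (cong (lookup periphery) (pm-unique pmP Px Pw (sym (trans vw vy)))) on)) λ ()
    cover : ∀ u → OffPeriphery G u → ∃ λ x → x Sub.∈ inner P × vert x ≡ u × (∀ y → y Sub.∈ inner P → vert y ≡ u → y ≡ x)
    cover u off-u with mate pmP u
    ... | x , Px , refl , unique = x
        , lookup⇒∈ (trans (lookup-inner P x) (cong₂ (λ p q → p ∧ not q) Px (Bₚ.¬-not λ on → periphery-vertex on off-u)))
        , refl , λ y y∈ → unique y (proj₁ (inner-member P y (∈⇒lookup y∈)))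

  ready₁ : Ready true N₁ zero
  ready₁ x fx = trans (cong (λ m → colour x xor m)
      (trans (lookup-symDiff M₀ periphery x) (cong (λ e → lookup M₀ x xor e) (on-boundary fx))))
    (go (colour x) (lookup M₀ x) (ready₀ x fx))
    where
    go : ∀ c m → c xor m ≡ false → c xor (m xor true) ≡ true
    go true true _ = refl
    go false false _ = refl

  -- In the alternative without inner vertices, both matchings are the empty set.
  forcing⇒unique : Forcing G → ∀ {A B} → IsPMOn G (OffPeriphery G) A → IsPMOn G (OffPeriphery G) B → A ≡ B
  forcing⇒unique (_ , inj₂ (M , _ , unique)) pmA pmB = trans (unique _ pmA) (sym (unique _ pmB))
  forcing⇒unique (_ , inj₁ none) {A} {B} pmA pmB = lookup-ext λ x → trans (empty pmA x) (sym (empty pmB x))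
    where
    empty : ∀ {S} → IsPMOn G (OffPeriphery G) S → ∀ x → lookup S x ≡ false
    empty (_ , off , _) x = Bₚ.¬-not λ Sx → none (vert x) (off x (lookup⇒∈ Sx))

  -- A face that can be raised in N₁ shares no edge with the periphery, so raising it changes the
  -- matching of the inner vertices.
  forcing⇒not-raisable : Forcing G → ∀ j → ¬ Ready true N₁ (suc j)
  forcing⇒not-raisable forcing j ready with face-surj (suc j)
  ... | x , fx = toggle (lookup N₁ x) (begin
        lookup N₁ x                                ≡⟨ sym (keep N₁) ⟩
        lookup (inner N₁) x                        ≡⟨ cong (λ S → lookup S x) same ⟩
        lookup (inner N₂) x                        ≡⟨ keep N₂ ⟩
        lookup N₂ x                                ≡⟨ lookup-symDiff N₁ (boundary G (suc j)) x ⟩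
        lookup N₁ x xor lookup (boundary G (suc j)) x ≡⟨ cong (λ e → lookup N₁ x xor e) (on-boundary fx) ⟩
        lookup N₁ x xor true                       ∎)
    where
    open ≡-Reasoning
    N₂ = flip N₁ (suc j)
    apart : ∀ y → face y ≡ zero → face (α y) ≢ suc j
    apart y fy fαy = contradiction (trans (sym (ready (α y) fαy)) (trans (state-α pm₁ y) (cong not (ready₁ y fy)))) λ ()
    ready₂ : Ready true N₂ zero
    ready₂ y fy = trans (cong (λ m → colour y xor m) (trans (lookup-symDiff N₁ (boundary G (suc j)) y)
      (trans (cong (λ e → lookup N₁ y xor e) (off-boundary (λ eq → contradiction (trans (sym fy) eq) λ ()) (apart y fy)))
             (Bₚ.xor-identityʳ (lookup N₁ y))))) (ready₁ y fy)
    same : inner N₁ ≡ inner N₂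
    same = forcing⇒unique forcing (inner-pm pm₁ ready₁) (inner-pm (flip-pm true pm₁ ready) ready₂)
    off-x : lookup periphery x ≡ false
    off-x = off-boundary (λ eq → contradiction (trans (sym fx) eq) λ ())
      λ fαx → apart (α x) fαx (trans (cong face (α-invol x)) fx)
    keep : ∀ P → lookup (inner P) x ≡ lookup P x
    keep P = trans (lookup-inner P x) (trans (cong (λ q → lookup P x ∧ not q) off-x) (Bₚ.∧-identityʳ (lookup P x)))
    toggle : ∀ m → m ≡ m xor true → ⊥
    toggle true ()
    toggle false ()

  -- A height of 2 or more lies above `N₁`, so `advance` would find a finite face at which `N₁` can
  -- be raised.
  forcing⇒binary : Forcing G → Binary
  forcing⇒binary forcing {M} pmM i = classify (height M (suc i)) refl
    where
    classify : ∀ h → height M (suc i) ≡ h → h ≡ 0ℤ ⊎ h ≡ 1ℤ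
    classify (+ zero) _ = inj₁ refl
    classify (+ suc zero) _ = inj₂ refl
    classify -[1+ h ] eq = contradiction (subst (0ℤ ℤ.≤_) eq (height≥0 pmM (suc i))) λ ()
    classify (+ suc (suc h)) eq = ⊥-elim (not-raisable (advance true pm₁ pmM i (subst (0ℤ ℤ.<_)
        (sym (trans (ℤₚ.*-identityˡ _) (cong₂ ℤ._-_ eq (height-N₁ i)))) (+<+ (s≤s z≤n)))))
      where
      not-raisable : ¬ (∃ λ j → 0ℤ ℤ.< sign true ℤ.* rise N₁ M (suc j) × Ready true N₁ (suc j))
      not-raisable (j , _ , ready) = forcing⇒not-raisable forcing j ready

  -- Periphery darts with a common tail have the same colour, so by `ready₀` both are in `M₀` or
  -- neither is. In the second case both are in `N₁`; a matching has one dart per vertex, so they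
  -- coincide either way. For the parity, the facial rotation `σ ∘ α` maps the white periphery darts
  -- bijectively onto the black ones.
  periphery-even-cycle : PeripheryEvenCycle G
  periphery-even-cycle = simple , (λ x y fx fy x≡αy → no-bridge y (trans fy (trans (sym fx) (cong face x≡αy)))) , whites , even
    where
    simple : ∀ x y → face x ≡ zero → face y ≡ zero → vert x ≡ vert y → x ≡ y
    simple x y fx fy vxy with lookup M₀ x in M₀x
    ... | true = pm-unique pm₀ M₀x (trans (xor≡false⇒≡ _ _ (ready₀ y fy)) (trans (cong col (sym vxy))
      (trans (sym (xor≡false⇒≡ _ _ (ready₀ x fx))) M₀x))) vxy
    ... | false = pm-unique pm₁ (in-N₁ x fx M₀x) (in-N₁ y fy (trans (xor≡false⇒≡ _ _ (ready₀ y fy)) (trans (cong col (sym vxy))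
      (trans (sym (xor≡false⇒≡ _ _ (ready₀ x fx))) M₀x)))) vxy
      where
      in-N₁ : ∀ z → face z ≡ zero → lookup M₀ z ≡ false → lookup N₁ z ≡ true
      in-N₁ z fz M₀z = trans (lookup-symDiff M₀ periphery z) (cong₂ _xor_ M₀z (on-boundary fz))
    outer? : Fin d → Bool
    outer? x = ⌊ face x ≟ zero ⌋
    white black : Fin d → ℕ
    white x = if outer? x then (if colour x then 1 else 0) else 0
    black x = if outer? x then (if colour x then 0 else 1) else 0
    whites : ℕ
    whites = sumℕ white
    rotation = permutation (σ ∘ α) (α ∘ σ⁻¹)
      (λ x → trans (cong σ (α-invol (σ⁻¹ x))) (σσ⁻¹ x)) (λ x → trans (cong α (σ⁻¹σ (α x))) (α-invol x))
    black-rotated : ∀ x → black (σ (α x)) ≡ white x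
    black-rotated x = trans (cong₂ (λ f c → if ⌊ f ≟ zero ⌋ then (if c then 0 else 1) else 0) (face-next x) (colour-next x))
      (go (outer? x) (colour x))
      where
      go : ∀ b c → (if b then (if not c then 0 else 1) else 0) ≡ (if b then (if c then 1 else 0) else 0)
      go true true = refl
      go true false = refl
      go false _ = refl
    even : Sub.∣ tabulate outer? ∣ ≡ 2 ℕ.* whites
    even = begin
      Sub.∣ tabulate outer? ∣                     ≡⟨ ∣tabulate∣ outer? ⟩
      sumℕ (λ x → if outer? x then 1 else 0)      ≡⟨ sumℕ-cong (λ x → by-colour (outer? x) (colour x)) ⟩
      sumℕ (λ x → white x ℕ.+ black x)            ≡⟨ sumℕ-+ white black ⟩
      whites ℕ.+ sumℕ black                       ≡⟨ cong (λ s → whites ℕ.+ s) (sumℕ-permute black rotation) ⟩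
      whites ℕ.+ sumℕ (λ x → black (σ (α x)))     ≡⟨ cong (λ s → whites ℕ.+ s) (sumℕ-cong black-rotated) ⟩
      whites ℕ.+ whites                           ≡⟨ cong (λ s → whites ℕ.+ s) (sym (ℕₚ.+-identityʳ whites)) ⟩
      2 ℕ.* whites                                ∎
      where
      open ≡-Reasoning
      by-colour : ∀ b c → (if b then 1 else 0) ≡
                  (if b then (if c then 1 else 0) else 0) ℕ.+ (if b then (if c then 0 else 1) else 0)
      by-colour true true = refl
      by-colour true false = refl
      by-colour false _ = refl

  -- A matching of the inner vertices is completed by the periphery edges of `M₀`, which cover all
  -- periphery vertices; this leaves the infinite face ready to be lowered.
  module Extension {A} (pmA : IsPMOn G (OffPeriphery G) A) where
    extension : Subset d
    extension = tabulate λ x → lookup A x ∨ (lookup M₀ x ∧ lookup periphery x)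

    lookup-extension : ∀ x → lookup extension x ≡ lookup A x ∨ (lookup M₀ x ∧ lookup periphery x)
    lookup-extension = lookup∘tabulate _

    A-off : ∀ {x} → lookup A x ≡ true → OffPeriphery G (vert x)
    A-off Ax = proj₁ (proj₂ pmA) _ (lookup⇒∈ Ax)

    extension-member : ∀ {x} → x Sub.∈ extension → lookup A x ≡ true ⊎ lookup M₀ x ≡ true × lookup periphery x ≡ true
    extension-member {x} x∈ = go (lookup A x) (lookup M₀ x) (lookup periphery x) (trans (sym (lookup-extension x)) (∈⇒lookup x∈))
      where
      go : ∀ a m p → a ∨ (m ∧ p) ≡ true → a ≡ true ⊎ m ≡ true × p ≡ true
      go true _ _ _ = inj₁ refl
      go false true true _ = inj₂ (refl , refl)

    member-A : ∀ {x} → lookup A x ≡ true → x Sub.∈ extension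
    member-A {x} Ax = lookup⇒∈ (trans (lookup-extension x) (cong (λ a → a ∨ (lookup M₀ x ∧ lookup periphery x)) Ax))

    member-M₀ : ∀ {x} → lookup M₀ x ≡ true → lookup periphery x ≡ true → x Sub.∈ extension
    member-M₀ {x} M₀x on = lookup⇒∈ (trans (lookup-extension x)
      (trans (cong₂ (λ m p → lookup A x ∨ (m ∧ p)) M₀x on) (Bₚ.∨-zeroʳ (lookup A x))))

    extension-pm : IsPM G extension
    extension-pm = closed-α , (λ _ _ → tt) , λ u _ → cover u
      where
      closed-α : ∀ x → x Sub.∈ extension → α x Sub.∈ extension
      closed-α x x∈ with extension-member x∈
      ... | inj₁ Ax = member-A (∈⇒lookup (proj₁ pmA x (lookup⇒∈ Ax)))
      ... | inj₂ (M₀x , on) = member-M₀ (trans (pm-α pm₀ x) M₀x) (trans (boundary-α zero x) on)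
      cover : ∀ u → ∃ λ x → x Sub.∈ extension × vert x ≡ u × (∀ y → y Sub.∈ extension → vert y ≡ u → y ≡ x)
      cover u with Finₚ.any? (λ y → (face y ≟ zero) ×-dec (vert y ≟ u))
      ... | yes (y , fy , refl) with periphery-matched pm₀ ready₀ fy
      ...   | w , M₀w , vw , on = w , member-M₀ M₀w on , vw , unique
        where
        unique : ∀ z → z Sub.∈ extension → vert z ≡ vert y → z ≡ w
        unique z z∈ vz with extension-member z∈
        ... | inj₁ Az = contradiction (sym vz) (A-off Az y fy)
        ... | inj₂ (M₀z , _) = pm-unique pm₀ M₀z M₀w (trans vz (sym vw))
      cover u | no none with proj₂ (proj₂ pmA) u (λ y fy vy → none (y , fy , vy))
      ...   | x , x∈ , refl , uniqueA = x , member-A (∈⇒lookup x∈) , refl , unique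
        where
        unique : ∀ z → z Sub.∈ extension → vert z ≡ vert x → z ≡ x
        unique z z∈ vz with extension-member z∈
        ... | inj₁ Az = uniqueA z (lookup⇒∈ Az) vz
        ... | inj₂ (_ , on) = contradiction (λ y fy vy → none (y , fy , trans vy vz)) (periphery-vertex on)

    A-inner : ∀ {x} → lookup periphery x ≡ true → lookup A x ≡ false
    A-inner on = Bₚ.¬-not λ Ax → periphery-vertex on (A-off Ax)

    extension-ready : Ready false extension zero
    extension-ready x fx = trans (cong (λ m → colour x xor m) (trans (lookup-extension x)
      (trans (cong₂ (λ a p → a ∨ (lookup M₀ x ∧ p)) (A-inner (on-boundary fx)) (on-boundary fx))
             (Bₚ.∧-identityʳ (lookup M₀ x))))) (ready₀ x fx)

    -- Lowering the infinite face adds one to every finite height. The heights were non-negative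
    -- before and are at most 1 after, so they were all 0, which are the heights of `M₀`.
    extension≡M₀ : Binary → extension ≡ M₀
    extension≡M₀ binary = height-injective extension-pm pm₀ λ
      { zero → trans (height-zero extension) (sym (height-zero M₀))
      ; (suc i) → trans (lowest _ _ (height≥0 extension-pm (suc i)) (rise-flip₀ extension-pm extension-ready i)
          (binary (flip-pm false extension-pm extension-ready) i)) (sym (height-M₀ (suc i))) }
      where
      lowest : ∀ h h′ → 0ℤ ℤ.≤ h → h′ ℤ.- h ≡ 1ℤ → h′ ≡ 0ℤ ⊎ h′ ≡ 1ℤ → h ≡ 0ℤ
      lowest (+ zero) _ _ _ _ = refl
      lowest (+ suc h) .(+ 0) _ () (inj₁ refl)
      lowest (+ suc zero) .(+ 1) _ () (inj₂ refl)
      lowest (+ suc (suc h)) .(+ 1) _ () (inj₂ refl)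
      lowest -[1+ h ] _ () _ _

    A≡inner : Binary → A ≡ inner M₀
    A≡inner binary = lookup-ext λ x → trans (recover x) (sym (lookup-inner M₀ x))
      where
      recover : ∀ x → lookup A x ≡ lookup M₀ x ∧ not (lookup periphery x)
      recover x with lookup periphery x in on
      ... | true = trans (A-inner on) (sym (Bₚ.∧-zeroʳ (lookup M₀ x)))
      ... | false = trans (sym (trans (lookup-extension x) (trans (cong (λ p → lookup A x ∨ (lookup M₀ x ∧ p)) on)
          (trans (cong (λ m → lookup A x ∨ m) (Bₚ.∧-zeroʳ (lookup M₀ x))) (Bₚ.∨-identityʳ (lookup A x))))))
        (trans (cong (λ S → lookup S x) (extension≡M₀ binary)) (sym (Bₚ.∧-identityʳ (lookup M₀ x))))

  binary⇒forcing : Binary → Forcing G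
  binary⇒forcing binary = periphery-even-cycle ,
    inj₂ (inner M₀ , inner-pm pm₀ ready₀ , λ A pmA → Extension.A≡inner pmA binary)

theorem3p1 : ∀ {d v n : ℕ} (G : PlaneGraph d v n) (col : Fin v → Bool)
    → ProperColoring G col → Elementary G → 1 ≤ n
    → (M₀ : Subset d) → IsBottom G col M₀
    → (∀ m → Embeds G m → n ≤ m)
      × (IdimIs G n ⇔ Forcing G)
      × (IdimIs G n → ∃ λ (c : Subset d → Vec Bool n)
           → (∀ M → IsPM G M → ∀ (i : Fin n)
                → PhiIs G col M₀ M (suc i) (if lookup (c M) i then 1 else 0))
           × Isometric G c
           × (∀ M M' → IsPM G M → IsPM G M'
                → ((_≤L_ G col M' M) ⇔ (∀ i → lookup (c M') i B.≤ lookup (c M) i))))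
theorem3p1 {n = suc _} G col proper elementary _ M₀ bottom =
  (λ _ → embeds⇒n≤)
  , mk⇔ (λ idim → binary⇒forcing (embeds⇒binary (proj₁ idim)))
        (λ forcing → binary⇒embeds (forcing⇒binary forcing) , λ _ → embeds⇒n≤)
  , λ idim → let binary = embeds⇒binary (proj₁ idim) in
      code , code-counts binary , code-isometric binary , code-order binary
  where open Coding G col proper elementary zero M₀ bottom
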